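{- Let $n\ge 1$ be an integer and let $s(m)=0$ if $m$ is even and $s(m)=*$ if $m$ is odd. The canonical form of \textsc{Snort} played on the (untinted) caterpillar $C(n+1,n,n+1)$ is \[\pm \Big\{\, 2n+1+s(n),\ \big\{ \{ 3n+2 \mid 2n+2+s(n-1) \} \ \big|\ s(n) \big\} \,\Big\},\] i.e. the game whose Left options are $2n+1+s(n)$ and $\big\{ \{ 3n+2 \mid 2n+2+s(n-1) \} \mid s(n) \big\}$ and whose Right options are the negatives of these.
   Context: \textsc{Snort} is a two-player normal-play combinatorial game (the player unable to move loses) between Left (blue) and Right (red), played on a finite simple graph; players alternately colour an uncoloured vertex in their own colour, and a player may not colour a vertex adjacent to a vertex coloured by the opponent. Game values are in the standard sense of combinatorial game theory: $\{A\mid B\}$ is the game with Left options $A$ and Right options $B$, $*=\{0\mid 0\}$, integers are the usual integer games, $\pm\{A,B\}$ denotes $\{A,B\mid -A,-B\}$, and the canonical form is the unique simplest game equal to the given one (no dominated or reversible options). The caterpillar $C(n+1,n,n+1)$ has vertex set $\{a,b,c,a_1,\dots,a_{n+1},b_1,\dots,b_n,c_1,\dots,c_{n+1}\}$ and edge set $\{ab,bc\}\cup\{a_ia, c_ic : 1\le i\le n+1\}\cup\{b_jb : 1\le j\le n\}$. -}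

module Defs where

open import Data.Bool using (if_then_else_)
open import Data.Empty using (⊥-elim)
open import Data.Fin as Fin using (Fin)
open import Data.List using (List; []; _∷_; _++_; map; filter; length; allFin; concatMap)
open import Data.List.Membership.Propositional using (_∈_; lose)
open import Data.List.Membership.Propositional.Properties using (∈-map⁺; ∈-allFin; ∈-concatMap⁺)
open import Data.List.Relation.Unary.All as All using ([]; _∷_; all?)
open import Data.List.Relation.Unary.AllPairs using (AllPairs; []; _∷_)
open import Data.List.Relation.Unary.Any using (here; there)
open import Data.Maybe using (Maybe; just; nothing)
import Data.Maybe.Properties as Maybe
open import Data.Nat using (ℕ; zero; suc)
open import Data.Product using (∃; _×_; _,_)
open import Data.Sum using (_⊎_; inj₁; inj₂)
open import Level using (0ℓ)
open import Relation.Binary using (Decidable; DecidableEquality; Irreflexive; Rel; Symmetric)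
open import Relation.Binary.Construct.Closure.Symmetric using (SymClosure; fwd; bwd; symmetric)
open import Relation.Binary.PropositionalEquality using (_≡_; _≢_; refl; sym; cong; subst)
open import Relation.Nullary using (Dec; yes; no; ¬_; does; _×-dec_; _⊎-dec_; _→-dec_; ¬?; map′)

data Game : Set where
  ⟨_∣_⟩ : List Game → List Game → Game

left right : Game → List Game
left  ⟨ ls ∣ _ ⟩ = ls
right ⟨ _ ∣ rs ⟩ = rs

infix 4 _≼_ _⧏_ _≈_

-- Conway's order: G ≼ H iff no left option of G is ≽ H and no right option
-- of H is ≼ G.  G ⧏ H is the positive form of ¬ (H ≼ G); see ⧏⇒⋡ and ⋡⇒⧏.
data _≼_ (G H : Game) : Set
data _⧏_ (G H : Game) : Set

data _≼_ G H where
  le : (∀ {X} → X ∈ left G → X ⧏ H) → (∀ {Y} → Y ∈ right H → G ⧏ Y) → G ≼ H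

data _⧏_ G H where
  viaˡ : ∀ {X} → X ∈ left H → G ≼ X → G ⧏ H
  viaʳ : ∀ {Y} → Y ∈ right G → Y ≼ H → G ⧏ H

⧏⇒⋡ : ∀ {G H} → G ⧏ H → ¬ (H ≼ G)
⧏⇒⋡ (viaˡ X∈ G≼X) (le f _) = ⧏⇒⋡ (f X∈) G≼X
⧏⇒⋡ (viaʳ Y∈ Y≼H) (le _ g) = ⧏⇒⋡ (g Y∈) Y≼H

mutual
  ≼-or-⧏ : ∀ G H → G ≼ H ⊎ H ⧏ G
  ≼-or-⧏ G@(⟨ ls ∣ _ ⟩) H@(⟨ _ ∣ rs ⟩) with lefts ls H | rights G rs
  ... | inj₂ (X , X∈ , H≼X) | _ = inj₂ (viaˡ X∈ H≼X)
  ... | inj₁ _ | inj₂ (Y , Y∈ , Y≼G) = inj₂ (viaʳ Y∈ Y≼G)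
  ... | inj₁ f | inj₁ g = inj₁ (le f g)

  lefts : ∀ ls H → (∀ {X} → X ∈ ls → X ⧏ H) ⊎ (∃ λ X → X ∈ ls × H ≼ X)
  lefts [] H = inj₁ λ ()
  lefts (X ∷ ls) H with ≼-or-⧏ H X | lefts ls H
  ... | inj₁ H≼X | _ = inj₂ (X , here refl , H≼X)
  ... | inj₂ _ | inj₂ (Z , Z∈ , H≼Z) = inj₂ (Z , there Z∈ , H≼Z)
  ... | inj₂ X⧏H | inj₁ f = inj₁ λ { (here refl) → X⧏H ; (there Z∈) → f Z∈ }

  rights : ∀ G rs → (∀ {Y} → Y ∈ rs → G ⧏ Y) ⊎ (∃ λ Y → Y ∈ rs × Y ≼ G)
  rights G [] = inj₁ λ ()
  rights G (Y ∷ rs) with ≼-or-⧏ Y G | rights G rs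
  ... | inj₁ Y≼G | _ = inj₂ (Y , here refl , Y≼G)
  ... | inj₂ _ | inj₂ (Z , Z∈ , Z≼G) = inj₂ (Z , there Z∈ , Z≼G)
  ... | inj₂ G⧏Y | inj₁ g = inj₁ λ { (here refl) → G⧏Y ; (there Z∈) → g Z∈ }

⋡⇒⧏ : ∀ {G H} → ¬ (H ≼ G) → G ⧏ H
⋡⇒⧏ {G} {H} H⋠G with ≼-or-⧏ H G
... | inj₁ H≼G = ⊥-elim (H⋠G H≼G)
... | inj₂ G⧏H = G⧏H

_≈_ : Game → Game → Set
G ≈ H = G ≼ H × H ≼ G

mutual
  neg : Game → Game
  neg ⟨ ls ∣ rs ⟩ = ⟨ negs rs ∣ negs ls ⟩

  negs : List Game → List Game
  negs []       = []
  negs (G ∷ Gs) = neg G ∷ negs Gs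

infixl 6 _⊕_

mutual
  _⊕_ : Game → Game → Game
  G@(⟨ ls ∣ rs ⟩) ⊕ H@(⟨ ls′ ∣ rs′ ⟩) =
    ⟨ eachˡ ls H ++ eachʳ G ls′ ∣ eachˡ rs H ++ eachʳ G rs′ ⟩

  eachˡ : List Game → Game → List Game
  eachˡ []       H = []
  eachˡ (G ∷ Gs) H = (G ⊕ H) ∷ eachˡ Gs H

  eachʳ : Game → List Game → List Game
  eachʳ G []       = []
  eachʳ G (H ∷ Hs) = (G ⊕ H) ∷ eachʳ G Hs

± : List Game → Game
± Gs = ⟨ Gs ∣ negs Gs ⟩

int : ℕ → Game
int zero    = ⟨ [] ∣ [] ⟩
int (suc m) = ⟨ int m ∷ [] ∣ [] ⟩

star : Game
star = ⟨ int 0 ∷ [] ∣ int 0 ∷ [] ⟩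

s : ℕ → Game
s zero          = int 0
s (suc zero)    = star
s (suc (suc m)) = s m

-- Options form a set, so a repeated entry of an option list counts as
-- dominated by its other copy.
NoDominated : Game → Set
NoDominated G = AllPairs Incomparable (left G) × AllPairs Incomparable (right G)
  where
  Incomparable : Game → Game → Set
  Incomparable X Y = ¬ (X ≼ Y) × ¬ (Y ≼ X)

NoReversible : Game → Set
NoReversible G =
  (∀ {X Xʳ} → X ∈ left G  → Xʳ ∈ right X → ¬ (Xʳ ≼ G)) ×
  (∀ {Y Yˡ} → Y ∈ right G → Yˡ ∈ left Y  → ¬ (G ≼ Yˡ))

data Canonical (G : Game) : Set where
  canonical : NoDominated G → NoReversible G →
              (∀ {X} → X ∈ left G → Canonical X) →
              (∀ {Y} → Y ∈ right G → Canonical Y) →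
              Canonical G

infix 4 _IsCanonicalFormOf_

_IsCanonicalFormOf_ : Game → Game → Set
K IsCanonicalFormOf G = Canonical K × K ≈ G

-- The canonical form of int m ⊕ s k, by +s-canonicalForm below.
infixl 6 _+s_

_+s_ : ℕ → ℕ → Game
m +s zero        = int m
m +s suc zero    = ⟨ int m ∷ [] ∣ int m ∷ [] ⟩
m +s suc (suc k) = m +s k

≼-refl : ∀ G → G ≼ G
≼-refl ⟨ ls ∣ rs ⟩ = le (λ X∈ → viaˡ X∈ (refls ls X∈)) (λ Y∈ → viaʳ Y∈ (refls rs Y∈))
  where
  refls : ∀ Gs {X} → X ∈ Gs → X ≼ X
  refls (G ∷ Gs) (here refl) = ≼-refl G
  refls (G ∷ Gs) (there X∈)  = refls Gs X∈

int⊕0 : ∀ m → int m ⊕ int 0 ≡ int m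
int⊕0 zero    = refl
int⊕0 (suc m) = cong (λ G → ⟨ G ∷ [] ∣ [] ⟩) (int⊕0 m)

int⊕star≼ : ∀ m → int m ⊕ star ≼ int (suc m)
int⊕star≼ zero = le (λ { (here refl) → viaˡ (here refl) (≼-refl _) }) λ ()
int⊕star≼ (suc m) = le
  (λ { (here refl)         → viaˡ (here refl) (int⊕star≼ m)
     ; (there (here refl)) → viaˡ (here refl) (subst (_≼ int (suc m)) (sym (int⊕0 (suc m))) (≼-refl _)) })
  λ ()

+star-≈ : ∀ m → m +s 1 ≈ int m ⊕ star
+star-≈ zero    = ≼-refl _ , ≼-refl _
+star-≈ (suc m) =
  le (λ { (here refl) → viaˡ (there (here refl)) m≼ })
     (λ { (here refl) → viaʳ (here refl) m≼ }) ,
  le (λ { (here refl)         → viaˡ (here refl) (int⊕star≼ m)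
        ; (there (here refl)) → viaˡ (here refl) ≼m })
     (λ { (here refl) → viaʳ (here refl) ≼m })
  where
  m≼ : int (suc m) ≼ int (suc m) ⊕ int 0
  m≼ = subst (int (suc m) ≼_) (sym (int⊕0 (suc m))) (≼-refl _)
  ≼m : int (suc m) ⊕ int 0 ≼ int (suc m)
  ≼m = subst (_≼ int (suc m)) (sym (int⊕0 (suc m))) (≼-refl _)

int-canonical : ∀ m → Canonical (int m)
int-canonical zero = canonical ([] , []) ((λ ()) , λ ()) (λ ()) λ ()
int-canonical (suc m) = canonical ([] ∷ [] , [])
  ((λ { (here refl) → λ Xʳ∈ → ⊥-elim (noRight m Xʳ∈) }) , λ ())
  (λ { (here refl) → int-canonical m }) λ ()
  where
  noRight : ∀ m {X} → ¬ (X ∈ right (int m))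
  noRight zero    ()
  noRight (suc m) ()

+star-canonical : ∀ m → Canonical (m +s 1)
+star-canonical m = canonical ([] ∷ [] , [] ∷ [])
  ((λ { (here refl) → noʳ m }) , λ { (here refl) → noˡ m })
  (λ { (here refl) → int-canonical m }) λ { (here refl) → int-canonical m }
  where
  noʳ : ∀ m {X} → X ∈ right (int m) → ¬ (X ≼ m +s 1)
  noʳ zero    ()
  noʳ (suc m) ()
  noˡ : ∀ m {X} → X ∈ left (int m) → ¬ (m +s 1 ≼ X)
  noˡ (suc m) (here refl) (le f _) =
    ⧏⇒⋡ (f (here refl)) (le (λ X∈ → viaˡ (here refl) (lem m X∈)) λ ())
    where
    lem : ∀ m {X} → X ∈ left (int m) → X ≼ int m
    lem (suc zero)    (here refl) = le (λ ()) λ ()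
    lem (suc (suc m)) (here refl) = le (λ X∈ → viaˡ (here refl) (lem (suc m) X∈)) λ ()

+s-canonicalForm : ∀ m k → m +s k IsCanonicalFormOf int m ⊕ s k
+s-canonicalForm m zero rewrite int⊕0 m = int-canonical m , ≼-refl _ , ≼-refl _
+s-canonicalForm m (suc zero)    = +star-canonical m , +star-≈ m
+s-canonicalForm m (suc (suc k)) = +s-canonicalForm m k

record FiniteGraph : Set₁ where
  field
    Vertex   : Set
    _≟_      : DecidableEquality Vertex
    vertices : List Vertex
    complete : ∀ v → v ∈ vertices
    Adj      : Rel Vertex 0ℓ
    adj?     : Decidable Adj
    adj-sym  : Symmetric Adj
    adj-irr  : Irreflexive _≡_ Adj

data Player : Set where
  Left Right : Player

opponent : Player → Player
opponent Left  = Right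
opponent Right = Left

_≟ᴾ_ : DecidableEquality Player
Left  ≟ᴾ Left  = yes refl
Left  ≟ᴾ Right = no λ ()
Right ≟ᴾ Left  = no λ ()
Right ≟ᴾ Right = yes refl

module Snort (Γ : FiniteGraph) where
  open FiniteGraph Γ

  Colouring : Set
  Colouring = Vertex → Maybe Player

  Legal : Player → Colouring → Vertex → Set
  Legal p σ v = σ v ≡ nothing × (∀ w → Adj v w → σ w ≢ just (opponent p))

  legal? : ∀ p σ v → Dec (Legal p σ v)
  legal? p σ v = Maybe.≡-dec _≟ᴾ_ (σ v) nothing ×-dec
    map′ (λ ok w → All.lookup ok (complete w)) (λ ok → All.tabulate λ {w} _ → ok w)
      (all? (λ w → adj? v w →-dec ¬? (Maybe.≡-dec _≟ᴾ_ (σ w) (just (opponent p)))) vertices)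

  colour : Player → Vertex → Colouring → Colouring
  colour p v σ w = if does (w ≟ v) then just p else σ w

  -- The first argument bounds the number of moves still to be played.
  play : ℕ → Colouring → Game
  play zero    σ = ⟨ [] ∣ [] ⟩
  play (suc k) σ = ⟨ options Left ∣ options Right ⟩
    where
    options : Player → List Game
    options p = map (λ v → play k (colour p v σ)) (filter (legal? p σ) vertices)

-- Each move colours a new vertex, so the bound never cuts play short.
snort : FiniteGraph → Game
snort Γ = Snort.play Γ (length (FiniteGraph.vertices Γ)) (λ _ → nothing)

data Spine : Set where
  a b c : Spine

module _ (p q r : ℕ) where

  leaves : Spine → ℕ
  leaves a = p
  leaves b = q
  leaves c = r

  data CatVertex : Set where
    spine : Spine → CatVertex
    leaf  : (x : Spine) → Fin (leaves x) → CatVertex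

  data CatEdge : CatVertex → CatVertex → Set where
    ab      : CatEdge (spine a) (spine b)
    bc      : CatEdge (spine b) (spine c)
    pendant : ∀ x i → CatEdge (leaf x i) (spine x)

  _≟ˢ_ : DecidableEquality Spine
  a ≟ˢ a = yes refl
  a ≟ˢ b = no λ ()
  a ≟ˢ c = no λ ()
  b ≟ˢ a = no λ ()
  b ≟ˢ b = yes refl
  b ≟ˢ c = no λ ()
  c ≟ˢ a = no λ ()
  c ≟ˢ b = no λ ()
  c ≟ˢ c = yes refl

  catVertex-≟ : DecidableEquality CatVertex
  catVertex-≟ (spine x) (spine y) = map′ (cong spine) (λ { refl → refl }) (x ≟ˢ y)
  catVertex-≟ (spine _) (leaf _ _) = no λ ()
  catVertex-≟ (leaf _ _) (spine _) = no λ ()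
  catVertex-≟ (leaf x i) (leaf y j) with x ≟ˢ y
  ... | no x≢y   = no λ { refl → x≢y refl }
  ... | yes refl = map′ (cong (leaf x)) (λ { refl → refl }) (i Fin.≟ j)

  catEdge? : Decidable CatEdge
  catEdge? (spine a) (spine a) = no λ ()
  catEdge? (spine a) (spine b) = yes ab
  catEdge? (spine a) (spine c) = no λ ()
  catEdge? (spine b) (spine a) = no λ ()
  catEdge? (spine b) (spine b) = no λ ()
  catEdge? (spine b) (spine c) = yes bc
  catEdge? (spine c) (spine y) = no λ ()
  catEdge? (spine _) (leaf _ _) = no λ ()
  catEdge? (leaf _ _) (leaf _ _) = no λ ()
  catEdge? (leaf x i) (spine y) =
    map′ (λ { refl → pendant x i }) (λ { (pendant _ _) → refl }) (x ≟ˢ y)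

  catVertices : List CatVertex
  catVertices = concatMap (λ x → spine x ∷ map (leaf x) (allFin (leaves x))) (a ∷ b ∷ c ∷ [])

  catVertices-complete : ∀ v → v ∈ catVertices
  catVertices-complete v = ∈-concatMap⁺ (λ x → spine x ∷ map (leaf x) (allFin (leaves x))) (lose (∈-spine (at v)) (inBlock v))
    where
    at : CatVertex → Spine
    at (spine x)  = x
    at (leaf x _) = x
    ∈-spine : ∀ x → x ∈ a ∷ b ∷ c ∷ []
    ∈-spine a = here refl
    ∈-spine b = there (here refl)
    ∈-spine c = there (there (here refl))
    inBlock : ∀ v → v ∈ spine (at v) ∷ map (leaf (at v)) (allFin (leaves (at v)))
    inBlock (spine x)  = here refl
    inBlock (leaf x i) = there (∈-map⁺ (leaf x) (∈-allFin i))

  caterpillar : FiniteGraph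
  caterpillar = record
    { Vertex   = CatVertex
    ; _≟_      = catVertex-≟
    ; vertices = catVertices
    ; complete = catVertices-complete
    ; Adj      = SymClosure CatEdge
    ; adj?     = λ v w → map′ (λ { (inj₁ e) → fwd e ; (inj₂ e) → bwd e })
                              (λ { (fwd e) → inj₁ e ; (bwd e) → inj₂ e })
                              (catEdge? v w ⊎-dec catEdge? w v)
    ; adj-sym  = symmetric CatEdge
    ; adj-irr  = λ { refl (fwd ()) ; refl (bwd ()) }
    }

{-# OPTIONS --safe #-}
-- Once a position contains no two adjacent spine vertices whose colouring can
-- interfere, it is the sum of three stars, and these have simple values: a dead
-- star with u leaves is s u, a star of colour Left is u, and a star whose centre
-- only Left may take is {u ∣ s (u ∸ 1)}.  Colouring b makes the sum of two such hot
-- stars and n, which is 2n + 1 + s n; colouring a threatens c, and Right's reply at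
-- c leaves s n.  Left's leaf moves are not useful: Right answers a leaf of a by
-- colouring b, and a leaf of b by colouring a, reaching a position ≼ the claimed form.
-- The start position equals its own negative, so the reverse inequality is free.
module Submission where

open import Defs
open import Data.Nat using (ℕ; _+_; _*_; _∸_; _≥_)
open import Data.List using (List; []; _∷_)

open import Algebra.Bundles using (AbelianGroup)
import Algebra.Properties.AbelianGroup as AbelianGroupProperties
import Algebra.Properties.CommutativeSemigroup as CommutativeSemigroupProperties
open import Data.Bool using (Bool; true; false)
open import Data.Fin using (Fin; zero; suc)
import Data.Fin.Properties as Fin
open import Data.List using (_++_; allFin; filter; length; map)
open import Data.List.Membership.Propositional using (_∈_)
open import Data.List.Membership.Propositional.Properties
  using (∈-++⁺ˡ; ∈-++⁺ʳ; ∈-++⁻; ∈-filter⁺; ∈-filter⁻; ∈-map⁺; ∈-map⁻)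
open import Data.List.Properties using (++-identityʳ; length-++; length-map; length-tabulate)
open import Data.List.Relation.Unary.All as All using ()
open import Data.List.Relation.Unary.AllPairs as AllPairs using (AllPairs)
import Data.List.Relation.Unary.AllPairs.Properties as AllPairs
open import Data.List.Relation.Unary.Any using (here; there)
open import Data.Maybe using (Maybe; just; nothing)
open import Data.Maybe.Properties using (just-injective)
open import Data.Nat using (suc; zero)
open import Data.Nat.Properties using (+-comm; +-identityʳ; +-suc; suc-injective)
open import Data.Nat.Tactic.RingSolver using (solve)
open import Data.Product using (∃; _×_; _,_; proj₁; proj₂; swap)
open import Data.Sum using (_⊎_; inj₁; inj₂)
open import Level using (0ℓ)
open import Relation.Binary.Construct.Closure.Symmetric using (bwd; fwd)
open import Relation.Binary.PropositionalEquality
  using (_≡_; _≢_; refl; sym; trans; cong; cong₂; subst; subst₂)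
open import Relation.Nullary using (¬_; contradiction; yes; no; Reflects; ofʸ; ofⁿ)

-- Games as an ordered abelian group

-- For symbolic n the option lists of `snort` cannot be enumerated: they have one entry per legal
-- vertex of a graph of unknown size. The uncoloured leaves of one star are interchangeable, though,
-- so a colouring is replaced by three leaf counts with a little data on the spine, and `Realises`
-- ties a game tree to such a state as a bisimulation, blind to the order and repetition of options.
-- All values are derived from that relation. The starting position and several of its successors do
-- not split into independent stars; they are treated by explicit replies, and every line of play
-- soon enters a sum of integers and nimbers 0 or *, where an inequality becomes an equation in ℕ.
-- Leaf moves fail for a quantitative reason. Right's reply makes the star that Left touched dead,
-- so that Left's next move brings at most 2, below the 2n + 1 + s n that Left can take in `form`,
-- while Right threatens to reach -(2n + 1 + s n) or less.

options : Player → Game → List Game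
options Left  = left
options Right = right

-- Inductions below reach an option through `X ∈ options p G`, which does not show X as a subterm of
-- G; recursion on `Wf` supplies the descent.
data Wf (G : Game) : Set where
  wf : (∀ p {X} → X ∈ options p G → Wf X) → Wf G

mutual
  wellFounded : ∀ G → Wf G
  wellFounded ⟨ ls ∣ rs ⟩ = wf λ { Left → allWf ls ; Right → allWf rs }

  allWf : ∀ Gs {X} → X ∈ Gs → Wf X
  allWf (G ∷ _)  (here refl) = wellFounded G
  allWf (_ ∷ Gs) (there X∈)  = allWf Gs X∈

mutual
  ≼-trans : ∀ {G H K} → G ≼ H → H ≼ K → G ≼ K
  ≼-trans G≼H@(le f g) H≼K@(le f′ g′) =
    le (λ X∈ → ⧏-≼-trans (f X∈) H≼K) (λ Y∈ → ≼-⧏-trans G≼H (g′ Y∈))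

  ⧏-≼-trans : ∀ {G H K} → G ⧏ H → H ≼ K → G ⧏ K
  ⧏-≼-trans (viaˡ X∈ G≼X) (le f _) = ≼-⧏-trans G≼X (f X∈)
  ⧏-≼-trans (viaʳ Y∈ Y≼H) H≼K      = viaʳ Y∈ (≼-trans Y≼H H≼K)

  ≼-⧏-trans : ∀ {G H K} → G ≼ H → H ⧏ K → G ⧏ K
  ≼-⧏-trans G≼H      (viaˡ X∈ H≼X) = viaˡ X∈ (≼-trans G≼H H≼X)
  ≼-⧏-trans (le _ g) (viaʳ Y∈ Y≼K) = ⧏-≼-trans (g Y∈) Y≼K

≼-byOptions : ∀ {G H} →
  (∀ {X} → X ∈ left G  → ∃ λ X′ → X′ ∈ left H  × X ≼ X′) →
  (∀ {Y} → Y ∈ right H → ∃ λ Y′ → Y′ ∈ right G × Y′ ≼ Y) → G ≼ H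
≼-byOptions f g = le (λ X∈ → let _ , X′∈ , X≼X′ = f X∈ in viaˡ X′∈ X≼X′)
                     (λ Y∈ → let _ , Y′∈ , Y′≼Y = g Y∈ in viaʳ Y′∈ Y′≼Y)

≈-byOptions : ∀ {G H} →
  (∀ p {X} → X ∈ options p G → ∃ λ X′ → X′ ∈ options p H × X ≈ X′) →
  (∀ p {X} → X ∈ options p H → ∃ λ X′ → X′ ∈ options p G × X ≈ X′) → G ≈ H
≈-byOptions f g =
  ≼-byOptions (λ X∈ → let _ , X′∈ , X≈ = f Left X∈ in _ , X′∈ , proj₁ X≈)
              (λ Y∈ → let _ , Y′∈ , Y≈ = g Right Y∈ in _ , Y′∈ , proj₂ Y≈) ,
  ≼-byOptions (λ X∈ → let _ , X′∈ , X≈ = g Left X∈ in _ , X′∈ , proj₁ X≈)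
              (λ Y∈ → let _ , Y′∈ , Y≈ = f Right Y∈ in _ , Y′∈ , proj₂ Y≈)

≈-refl : ∀ {G} → G ≈ G
≈-refl = ≼-refl _ , ≼-refl _

≈-reflexive : ∀ {G H} → G ≡ H → G ≈ H
≈-reflexive refl = ≈-refl

≈-sym : ∀ {G H} → G ≈ H → H ≈ G
≈-sym = swap

≈-trans : ∀ {G H K} → G ≈ H → H ≈ K → G ≈ K
≈-trans (p , p′) (q , q′) = ≼-trans p q , ≼-trans q′ p′

eachˡ≡map : ∀ Gs H → eachˡ Gs H ≡ map (_⊕ H) Gs
eachˡ≡map []       H = refl
eachˡ≡map (G ∷ Gs) H = cong (G ⊕ H ∷_) (eachˡ≡map Gs H)

eachʳ≡map : ∀ G Hs → eachʳ G Hs ≡ map (G ⊕_) Hs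
eachʳ≡map G []       = refl
eachʳ≡map G (H ∷ Hs) = cong (G ⊕ H ∷_) (eachʳ≡map G Hs)

options-⊕ : ∀ p G H → options p (G ⊕ H) ≡ map (_⊕ H) (options p G) ++ map (G ⊕_) (options p H)
options-⊕ Left  G@(⟨ ls ∣ _ ⟩) H@(⟨ ls′ ∣ _ ⟩) = cong₂ _++_ (eachˡ≡map ls H) (eachʳ≡map G ls′)
options-⊕ Right G@(⟨ _ ∣ rs ⟩) H@(⟨ _ ∣ rs′ ⟩) = cong₂ _++_ (eachˡ≡map rs H) (eachʳ≡map G rs′)

-- A view: matching on it exposes an option of a sum as a sum again, together with the summand that
-- was moved in.
data ⊕-Option (p : Player) (G H : Game) : Game → Set where
  onˡ : ∀ {X} → X ∈ options p G → ⊕-Option p G H (X ⊕ H)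
  onʳ : ∀ {X} → X ∈ options p H → ⊕-Option p G H (G ⊕ X)

⊕-option⁻ : ∀ p G H {X} → X ∈ options p (G ⊕ H) → ⊕-Option p G H X
⊕-option⁻ p G H X∈ with ∈-++⁻ (map (_⊕ H) (options p G)) (subst (_ ∈_) (options-⊕ p G H) X∈)
... | inj₁ X∈ˡ with _ , Z∈ , refl ← ∈-map⁻ (_⊕ H) X∈ˡ = onˡ Z∈
... | inj₂ X∈ʳ with _ , Z∈ , refl ← ∈-map⁻ (G ⊕_) X∈ʳ = onʳ Z∈

⊕-onˡ : ∀ p G H {X} → X ∈ options p G → X ⊕ H ∈ options p (G ⊕ H)
⊕-onˡ p G H X∈ = subst (_ ∈_) (sym (options-⊕ p G H)) (∈-++⁺ˡ (∈-map⁺ (_⊕ H) X∈))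

⊕-onʳ : ∀ p G H {X} → X ∈ options p H → G ⊕ X ∈ options p (G ⊕ H)
⊕-onʳ p G H X∈ = subst (_ ∈_) (sym (options-⊕ p G H)) (∈-++⁺ʳ (map (_⊕ H) (options p G)) (∈-map⁺ (G ⊕_) X∈))

negs≡map : ∀ Gs → negs Gs ≡ map neg Gs
negs≡map []       = refl
negs≡map (G ∷ Gs) = cong (neg G ∷_) (negs≡map Gs)

mutual
  neg-involutive : ∀ G → neg (neg G) ≡ G
  neg-involutive ⟨ ls ∣ rs ⟩ = cong₂ ⟨_∣_⟩ (negs-involutive ls) (negs-involutive rs)

  negs-involutive : ∀ Gs → negs (negs Gs) ≡ Gs
  negs-involutive []       = refl
  negs-involutive (G ∷ Gs) = cong₂ _∷_ (neg-involutive G) (negs-involutive Gs)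

options-neg : ∀ p G → options p (neg G) ≡ map neg (options (opponent p) G)
options-neg Left  ⟨ ls ∣ rs ⟩ = negs≡map rs
options-neg Right ⟨ ls ∣ rs ⟩ = negs≡map ls

neg-option⁻ : ∀ p G {X} → X ∈ options p (neg G) → ∃ λ Z → Z ∈ options (opponent p) G × X ≡ neg Z
neg-option⁻ p G X∈ = ∈-map⁻ neg (subst (_ ∈_) (options-neg p G) X∈)

neg-option⁺ : ∀ p G {X} → X ∈ options (opponent p) G → neg X ∈ options p (neg G)
neg-option⁺ p G X∈ = subst (_ ∈_) (sym (options-neg p G)) (∈-map⁺ neg X∈)

mutual
  neg-antitone : ∀ {G H} → G ≼ H → neg H ≼ neg G
  neg-antitone {G} {H} (le f g) = le
    (λ X∈ → let _ , Z∈ , eq = neg-option⁻ Left H X∈ in subst (_⧏ neg G) (sym eq) (neg-antitone-⧏ (g Z∈)))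
    (λ Y∈ → let _ , Z∈ , eq = neg-option⁻ Right G Y∈ in subst (neg H ⧏_) (sym eq) (neg-antitone-⧏ (f Z∈)))

  neg-antitone-⧏ : ∀ {G H} → G ⧏ H → neg H ⧏ neg G
  neg-antitone-⧏ {G} {H} (viaˡ X∈ G≼X) = viaʳ (neg-option⁺ Right H X∈) (neg-antitone G≼X)
  neg-antitone-⧏ {G} {H} (viaʳ Y∈ Y≼H) = viaˡ (neg-option⁺ Left G Y∈) (neg-antitone Y≼H)

neg-cong : ∀ {G H} → G ≈ H → neg G ≈ neg H
neg-cong (p , q) = neg-antitone q , neg-antitone p

mutual
  -- A move in the compared summand descends in the derivation of `≼` or `⧏`; a move in the common
  -- summand descends in `Wf H`.
  ⊕-monoˡ′ : ∀ {G G′ H} → Wf H → G ≼ G′ → G ⊕ H ≼ G′ ⊕ H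
  ⊕-monoˡ′ w p = le (λ X∈ → ⊕-monoˡ-left w p (⊕-option⁻ Left _ _ X∈))
                    (λ Y∈ → ⊕-monoˡ-right w p (⊕-option⁻ Right _ _ Y∈))

  ⊕-monoˡ-⧏ : ∀ {G G′ H} → Wf H → G ⧏ G′ → G ⊕ H ⧏ G′ ⊕ H
  ⊕-monoˡ-⧏ {G} {G′} {H} w (viaˡ X∈ p) = viaˡ (⊕-onˡ Left G′ H X∈) (⊕-monoˡ′ w p)
  ⊕-monoˡ-⧏ {G} {G′} {H} w (viaʳ Y∈ p) = viaʳ (⊕-onˡ Right G H Y∈) (⊕-monoˡ′ w p)

  ⊕-monoˡ-left : ∀ {G G′ H X} → Wf H → G ≼ G′ → ⊕-Option Left G H X → X ⧏ G′ ⊕ H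
  ⊕-monoˡ-left w      (le f _) (onˡ X∈) = ⊕-monoˡ-⧏ w (f X∈)
  ⊕-monoˡ-left (wf h) p        (onʳ X∈) = viaˡ (⊕-onʳ Left _ _ X∈) (⊕-monoˡ′ (h Left X∈) p)

  ⊕-monoˡ-right : ∀ {G G′ H Y} → Wf H → G ≼ G′ → ⊕-Option Right G′ H Y → G ⊕ H ⧏ Y
  ⊕-monoˡ-right w      (le _ g) (onˡ Y∈) = ⊕-monoˡ-⧏ w (g Y∈)
  ⊕-monoˡ-right (wf h) p        (onʳ Y∈) = viaʳ (⊕-onʳ Right _ _ Y∈) (⊕-monoˡ′ (h Right Y∈) p)

⊕-monoˡ : ∀ {G G′} H → G ≼ G′ → G ⊕ H ≼ G′ ⊕ H
⊕-monoˡ H = ⊕-monoˡ′ (wellFounded H)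

mutual
  ⊕-comm′ : ∀ {G H} → Wf G → Wf H → G ⊕ H ≈ H ⊕ G
  ⊕-comm′ u v = ≈-byOptions (λ p X∈ → ⊕-comm-option p u v (⊕-option⁻ p _ _ X∈))
                            (λ p X∈ → ⊕-comm-option p v u (⊕-option⁻ p _ _ X∈))

  ⊕-comm-option : ∀ p {G H X} → Wf G → Wf H → ⊕-Option p G H X → ∃ λ X′ → X′ ∈ options p (H ⊕ G) × X ≈ X′
  ⊕-comm-option p (wf g) v (onˡ X∈) = _ , ⊕-onʳ p _ _ X∈ , ⊕-comm′ (g p X∈) v
  ⊕-comm-option p u (wf h) (onʳ X∈) = _ , ⊕-onˡ p _ _ X∈ , ⊕-comm′ u (h p X∈)

⊕-comm : ∀ G H → G ⊕ H ≈ H ⊕ G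
⊕-comm G H = ⊕-comm′ (wellFounded G) (wellFounded H)

⊕-monoʳ : ∀ G {H H′} → H ≼ H′ → G ⊕ H ≼ G ⊕ H′
⊕-monoʳ G H≼H′ = ≼-trans (proj₁ (⊕-comm G _)) (≼-trans (⊕-monoˡ G H≼H′) (proj₁ (⊕-comm _ G)))

⊕-mono : ∀ {G G′ H H′} → G ≼ G′ → H ≼ H′ → G ⊕ H ≼ G′ ⊕ H′
⊕-mono G≼G′ H≼H′ = ≼-trans (⊕-monoˡ _ G≼G′) (⊕-monoʳ _ H≼H′)

⊕-cong : ∀ {G G′ H H′} → G ≈ G′ → H ≈ H′ → G ⊕ H ≈ G′ ⊕ H′
⊕-cong (p , p′) (q , q′) = ⊕-mono p q , ⊕-mono p′ q′

mutual
  ⊕-assoc′ : ∀ {G H K} → Wf G → Wf H → Wf K → G ⊕ H ⊕ K ≈ G ⊕ (H ⊕ K)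
  ⊕-assoc′ u v w = ≈-byOptions (λ p X∈ → ⊕-assoc-option p u v w (⊕-option⁻ p _ _ X∈))
                               (λ p X∈ → ⊕-assoc-option⁻ p u v w (⊕-option⁻ p _ _ X∈))

  ⊕-assoc-option : ∀ p {G H K X} → Wf G → Wf H → Wf K → ⊕-Option p (G ⊕ H) K X →
                   ∃ λ X′ → X′ ∈ options p (G ⊕ (H ⊕ K)) × X ≈ X′
  ⊕-assoc-option p {G} {H} u v w (onˡ X∈) with ⊕-option⁻ p G H X∈
  ⊕-assoc-option p (wf g) v w (onˡ X∈) | onˡ Z∈ = _ , ⊕-onˡ p _ _ Z∈ , ⊕-assoc′ (g p Z∈) v w
  ⊕-assoc-option p {H = H} {K} u (wf h) w (onˡ X∈) | onʳ Z∈ =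
    _ , ⊕-onʳ p _ _ (⊕-onˡ p H K Z∈) , ⊕-assoc′ u (h p Z∈) w
  ⊕-assoc-option p {H = H} {K} u v (wf k) (onʳ Z∈) =
    _ , ⊕-onʳ p _ _ (⊕-onʳ p H K Z∈) , ⊕-assoc′ u v (k p Z∈)

  ⊕-assoc-option⁻ : ∀ p {G H K X} → Wf G → Wf H → Wf K → ⊕-Option p G (H ⊕ K) X →
                    ∃ λ X′ → X′ ∈ options p (G ⊕ H ⊕ K) × X ≈ X′
  ⊕-assoc-option⁻ p {G} {H} (wf g) v w (onˡ Z∈) =
    _ , ⊕-onˡ p _ _ (⊕-onˡ p G H Z∈) , ≈-sym (⊕-assoc′ (g p Z∈) v w)
  ⊕-assoc-option⁻ p {H = H} {K} u v w (onʳ X∈) with ⊕-option⁻ p H K X∈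
  ⊕-assoc-option⁻ p {G} {H} u (wf h) w (onʳ X∈) | onˡ Z∈ =
    _ , ⊕-onˡ p _ _ (⊕-onʳ p G H Z∈) , ≈-sym (⊕-assoc′ u (h p Z∈) w)
  ⊕-assoc-option⁻ p u v (wf k) (onʳ X∈) | onʳ Z∈ = _ , ⊕-onʳ p _ _ Z∈ , ≈-sym (⊕-assoc′ u v (k p Z∈))

⊕-assoc : ∀ G H K → G ⊕ H ⊕ K ≈ G ⊕ (H ⊕ K)
⊕-assoc G H K = ⊕-assoc′ (wellFounded G) (wellFounded H) (wellFounded K)

int0-options : ∀ p {X} → ¬ X ∈ options p (int 0)
int0-options Left  ()
int0-options Right ()

mutual
  ⊕-identityʳ′ : ∀ {G} → Wf G → G ⊕ int 0 ≈ G
  ⊕-identityʳ′ u = ≈-byOptions (λ p X∈ → ⊕-identityʳ-option p u (⊕-option⁻ p _ _ X∈))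
                               (λ p X∈ → ⊕-identityʳ-option⁻ p u X∈)

  ⊕-identityʳ-option : ∀ p {G X} → Wf G → ⊕-Option p G (int 0) X → ∃ λ X′ → X′ ∈ options p G × X ≈ X′
  ⊕-identityʳ-option p (wf g) (onˡ X∈) = _ , X∈ , ⊕-identityʳ′ (g p X∈)
  ⊕-identityʳ-option p _      (onʳ X∈) = contradiction X∈ (int0-options p)

  ⊕-identityʳ-option⁻ : ∀ p {G X} → Wf G → X ∈ options p G → ∃ λ X′ → X′ ∈ options p (G ⊕ int 0) × X ≈ X′
  ⊕-identityʳ-option⁻ p (wf g) X∈ = _ , ⊕-onˡ p _ _ X∈ , ≈-sym (⊕-identityʳ′ (g p X∈))

⊕-identityʳ : ∀ G → G ⊕ int 0 ≈ G
⊕-identityʳ G = ⊕-identityʳ′ (wellFounded G)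

mutual
  ⊕-inverseʳ′ : ∀ {G} → Wf G → G ⊕ neg G ≈ int 0
  ⊕-inverseʳ′ u = le (λ X∈ → proj₁ (⊕-inverse-reply Left u (⊕-option⁻ Left _ _ X∈)) refl) (λ ()) ,
                  le (λ ()) (λ Y∈ → proj₂ (⊕-inverse-reply Right u (⊕-option⁻ Right _ _ Y∈)) refl)

  -- The Tweedledum-Tweedledee strategy: a move in one summand is answered by its negative in the
  -- other.
  ⊕-inverse-reply : ∀ p {G X} → Wf G → ⊕-Option p G (neg G) X →
                    (p ≡ Left → X ⧏ int 0) × (p ≡ Right → int 0 ⧏ X)
  ⊕-inverse-reply p {G} (wf g) (onˡ {X} X∈) =
    (λ { refl → viaʳ (⊕-onʳ Right X _ (neg-option⁺ Right G X∈)) (proj₁ (⊕-inverseʳ′ (g Left X∈))) }) ,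
    (λ { refl → viaˡ (⊕-onʳ Left X _ (neg-option⁺ Left G X∈)) (proj₂ (⊕-inverseʳ′ (g Right X∈))) })
  ⊕-inverse-reply p {G} u (onʳ X∈) with neg-option⁻ p G X∈
  ⊕-inverse-reply p {G} (wf g) (onʳ X∈) | _ , Z∈ , refl =
    (λ { refl → viaʳ (⊕-onˡ Right G _ Z∈) (proj₁ (⊕-inverseʳ′ (g Right Z∈))) }) ,
    (λ { refl → viaˡ (⊕-onˡ Left G _ Z∈) (proj₂ (⊕-inverseʳ′ (g Left Z∈))) })

⊕-inverseʳ : ∀ G → G ⊕ neg G ≈ int 0
⊕-inverseʳ G = ⊕-inverseʳ′ (wellFounded G)

gameGroup : AbelianGroup 0ℓ 0ℓ
gameGroup = record
  { Carrier = Game ; _≈_ = _≈_ ; _∙_ = _⊕_ ; ε = int 0 ; _⁻¹ = neg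
  ; isAbelianGroup = record
    { isGroup = record
      { isMonoid = record
        { isSemigroup = record
          { isMagma = record
            { isEquivalence = record { refl = ≈-refl ; sym = ≈-sym ; trans = ≈-trans }
            ; ∙-cong = ⊕-cong }
          ; assoc = ⊕-assoc }
        ; identity = (λ G → ≈-trans (⊕-comm _ G) (⊕-identityʳ G)) , ⊕-identityʳ }
      ; inverse = (λ G → ≈-trans (⊕-comm _ G) (⊕-inverseʳ G)) , ⊕-inverseʳ
      ; ⁻¹-cong = neg-cong }
    ; comm = ⊕-comm } }

open AbelianGroup gameGroup using () renaming (identityˡ to ⊕-identityˡ)
open AbelianGroupProperties gameGroup using (⁻¹-∙-comm)
open CommutativeSemigroupProperties (AbelianGroup.commutativeSemigroup gameGroup) using (interchange; x∙yz≈y∙xz)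

-- Positions as triples of stars

-- The part of a position on one spine vertex and its u uncoloured leaves; in
-- blank l r u the spine vertex is uncoloured, and l (r) says whether Left (Right)
-- may still colour it.
data Star : Set where
  blank    : (l r : Bool) (u : ℕ) → Star
  coloured : Player → (u : ℕ) → Star

data State : Set where
  ⟪_,_,_⟫ : (x y z : Star) → State

-- What happens to a star when a neighbour of its spine vertex receives colour p: the opponent loses
-- access to that spine vertex if it is still uncoloured.
restrict : Player → Star → Star
restrict Left  (blank l r u)  = blank l false u
restrict Right (blank l r u)  = blank false r u
restrict _     (coloured q u) = coloured q u

-- A coloured leaf also bars the opponent from an uncoloured spine vertex. No constructor covers a
-- star of the opponent's colour, whose leaves are out of reach.
data LeafMove (p : Player) : Star → Star → Set where
  onOpen : ∀ {l r u} → LeafMove p (blank l r (suc u)) (restrict p (blank l r u))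
  onOwn  : ∀ {u} → LeafMove p (coloured p (suc u)) (coloured p u)

data CentreMove : Player → Star → Star → Set where
  byLeft  : ∀ {r u} → CentreMove Left  (blank true r u) (coloured Left u)
  byRight : ∀ {l u} → CentreMove Right (blank l true u) (coloured Right u)

data Move (p : Player) : State → State → Set where
  leafᵃ   : ∀ {x x′ y z} → LeafMove p x x′ → Move p ⟪ x , y , z ⟫ ⟪ x′ , y , z ⟫
  leafᵇ   : ∀ {x y y′ z} → LeafMove p y y′ → Move p ⟪ x , y , z ⟫ ⟪ x , y′ , z ⟫
  leafᶜ   : ∀ {x y z z′} → LeafMove p z z′ → Move p ⟪ x , y , z ⟫ ⟪ x , y , z′ ⟫
  centreᵃ : ∀ {x x′ y z} → CentreMove p x x′ → Move p ⟪ x , y , z ⟫ ⟪ x′ , restrict p y , z ⟫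
  centreᵇ : ∀ {x y y′ z} → CentreMove p y y′ → Move p ⟪ x , y , z ⟫ ⟪ restrict p x , y′ , restrict p z ⟫
  centreᶜ : ∀ {x y z z′} → CentreMove p z z′ → Move p ⟪ x , y , z ⟫ ⟪ x , restrict p y , z′ ⟫

-- The two clauses are the halves of a bisimulation. One state move stands for the moves on all
-- equivalent leaves, which are separate entries in the option lists of `play`.
data Realises (st : State) (G : Game) : Set where
  realises : (∀ p {X} → X ∈ options p G → ∃ λ st′ → Move p st st′ × Realises st′ X) →
             (∀ p {st′} → Move p st st′ → ∃ λ X → X ∈ options p G × Realises st′ X) →
             Realises st G

-- Exchange of the two colours

opponent-involutive : ∀ p → opponent (opponent p) ≡ p
opponent-involutive Left  = refl
opponent-involutive Right = refl

swapStar : Star → Star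
swapStar (blank l r u)  = blank r l u
swapStar (coloured p u) = coloured (opponent p) u

swapState : State → State
swapState ⟪ x , y , z ⟫ = ⟪ swapStar x , swapStar y , swapStar z ⟫

swapStar-involutive : ∀ x → swapStar (swapStar x) ≡ x
swapStar-involutive (blank l r u)  = refl
swapStar-involutive (coloured p u) = cong (λ q → coloured q u) (opponent-involutive p)

swapState-involutive : ∀ st → swapState (swapState st) ≡ st
swapState-involutive ⟪ x , y , z ⟫
  rewrite swapStar-involutive x | swapStar-involutive y | swapStar-involutive z = refl

restrict-swap : ∀ p x → restrict (opponent p) (swapStar x) ≡ swapStar (restrict p x)
restrict-swap Left  (blank l r u)  = refl
restrict-swap Right (blank l r u)  = refl
restrict-swap Left  (coloured p u) = refl
restrict-swap Right (coloured p u) = refl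

swap-leafMove : ∀ {p x x′} → LeafMove p x x′ → LeafMove (opponent p) (swapStar x) (swapStar x′)
swap-leafMove {Left}  onOpen = onOpen
swap-leafMove {Right} onOpen = onOpen
swap-leafMove onOwn = onOwn

swap-centreMove : ∀ {p x x′} → CentreMove p x x′ → CentreMove (opponent p) (swapStar x) (swapStar x′)
swap-centreMove byLeft  = byRight
swap-centreMove byRight = byLeft

swap-move : ∀ {p st st′} → Move p st st′ → Move (opponent p) (swapState st) (swapState st′)
swap-move (leafᵃ m) = leafᵃ (swap-leafMove m)
swap-move (leafᵇ m) = leafᵇ (swap-leafMove m)
swap-move (leafᶜ m) = leafᶜ (swap-leafMove m)
swap-move {p} (centreᵃ {y = y} m) rewrite sym (restrict-swap p y) = centreᵃ (swap-centreMove m)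
swap-move {p} (centreᵇ {x} {z = z} m) rewrite sym (restrict-swap p x) | sym (restrict-swap p z) =
  centreᵇ (swap-centreMove m)
swap-move {p} (centreᶜ {y = y} m) rewrite sym (restrict-swap p y) = centreᶜ (swap-centreMove m)

-- Exchanging the colours negates the game; values computed for Left's moves are carried over to
-- Right's in this way.
swap-realises : ∀ {st G} → Wf G → Realises st G → Realises (swapState st) (neg G)
swap-realises {st} {G} (wf g) (realises f f⁻) = realises
  (λ p X∈ → let Z , Z∈ , eq  = neg-option⁻ p G X∈
                st′ , move , r = f (opponent p) Z∈
            in swapState st′ , subst (λ q → Move q _ (swapState st′)) (opponent-involutive p) (swap-move move) ,
               subst (Realises _) (sym eq) (swap-realises (g (opponent p) Z∈) r))
  (λ p {st′} move →
    let X , X∈ , r = f⁻ (opponent p) (subst (λ s → Move (opponent p) s (swapState st′))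
                                            (swapState-involutive st) (swap-move move))
    in _ , neg-option⁺ p G X∈ ,
       subst (λ s → Realises s (neg X)) (swapState-involutive st′) (swap-realises (g (opponent p) X∈) r))

option⇒ : ∀ {st G} → Realises st G → ∀ p {X} → X ∈ options p G → ∃ λ st′ → Move p st st′ × Realises st′ X
option⇒ (realises f _) = f

move⇒ : ∀ {st G} → Realises st G → ∀ p {st′} → Move p st st′ → ∃ λ X → X ∈ options p G × Realises st′ X
move⇒ (realises _ f) = f

-- Separated positions as sums of stars

centreOption : Bool → Game → List Game
centreOption true  G = G ∷ []
centreOption false G = []

-- The star played on its own, with a player's equivalent leaf moves entered once. Without leaves,
-- colouring the centre ends play at 0 for either player.
openStar : Bool → Bool → ℕ → Game
openStar l r zero    = ⟨ centreOption l (int 0) ∣ centreOption r (int 0) ⟩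
openStar l r (suc u) =
  ⟨ openStar l false u ∷ centreOption l (int (suc u)) ∣ openStar false r u ∷ centreOption r (neg (int (suc u))) ⟩

val : Star → Game
val (blank l r u)      = openStar l r u
val (coloured Left u)  = int u
val (coloured Right u) = neg (int u)

data StarMove (p : Player) (x x′ : Star) : Set where
  leafMove   : LeafMove p x x′ → StarMove p x x′
  centreMove : CentreMove p x x′ → StarMove p x x′

val-option⁻ : ∀ p x {X} → X ∈ options p (val x) → ∃ λ x′ → StarMove p x x′ × X ≡ val x′
val-option⁻ Left  (blank true r zero)       (here refl)         = _ , centreMove byLeft , refl
val-option⁻ Right (blank l true zero)       (here refl)         = _ , centreMove byRight , refl
val-option⁻ Left  (blank l r (suc u))       (here refl)         = _ , leafMove onOpen , refl
val-option⁻ Right (blank l r (suc u))       (here refl)         = _ , leafMove onOpen , refl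
val-option⁻ Left  (blank true r (suc u))    (there (here refl)) = _ , centreMove byLeft , refl
val-option⁻ Right (blank l true (suc u))    (there (here refl)) = _ , centreMove byRight , refl
val-option⁻ Left  (coloured Left (suc u))   (here refl)         = _ , leafMove onOwn , refl
val-option⁻ Right (coloured Right (suc u))  (here refl)         = _ , leafMove onOwn , refl
val-option⁻ Right (coloured Left zero)      ()
val-option⁻ Right (coloured Left (suc u))   ()
val-option⁻ Left  (coloured Right zero)     ()
val-option⁻ Left  (coloured Right (suc u))  ()

val-option⁺ : ∀ {p x x′} → StarMove p x x′ → val x′ ∈ options p (val x)
val-option⁺ {Left}  (leafMove onOpen) = here refl
val-option⁺ {Right} (leafMove onOpen) = here refl
val-option⁺ {Left}  (leafMove onOwn)  = here refl
val-option⁺ {Right} (leafMove onOwn)  = here refl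
val-option⁺ (centreMove (byLeft {u = zero}))   = here refl
val-option⁺ (centreMove (byLeft {u = suc _}))  = there (here refl)
val-option⁺ (centreMove (byRight {u = zero}))  = here refl
val-option⁺ (centreMove (byRight {u = suc _})) = there (here refl)

-- Spine neighbours act on each other only through `restrict`. The condition holds when x has no
-- centre move, when y is coloured, or when the rights that would be lost are gone already.
Unaffected : Star → Star → Set
Unaffected x y = ∀ {p x′} → CentreMove p x x′ → restrict p y ≡ y

Independent : Star → Star → Set
Independent x y = Unaffected x y × Unaffected y x

leafMove-reflects-centre : ∀ {p q x x′ x″} → LeafMove p x x′ → CentreMove q x′ x″ → ∃ (CentreMove q x)
leafMove-reflects-centre {Left}  onOpen byLeft  = _ , byLeft
leafMove-reflects-centre {Right} onOpen byRight = _ , byRight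

restrict-leafMove : ∀ {p x x′} q → LeafMove p x x′ → restrict q x ≡ x → restrict q x′ ≡ x′
restrict-leafMove {Left}  Left  onOpen refl = refl
restrict-leafMove {Left}  Right onOpen refl = refl
restrict-leafMove {Right} Left  onOpen refl = refl
restrict-leafMove {Right} Right onOpen refl = refl
restrict-leafMove Left  onOwn _ = refl
restrict-leafMove Right onOwn _ = refl

centreMove-target : ∀ {p q x x′ x″} → CentreMove p x x′ → ¬ CentreMove q x′ x″
centreMove-target byLeft  ()
centreMove-target byRight ()

restrict-centreMove : ∀ {p x x′} q → CentreMove p x x′ → restrict q x′ ≡ x′
restrict-centreMove Left  byLeft  = refl
restrict-centreMove Right byLeft  = refl
restrict-centreMove Left  byRight = refl
restrict-centreMove Right byRight = refl

-- Moves never revive a right: a leaf move opens no new centre move, and a coloured star is fixed by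
-- `restrict`.
independent-step : ∀ {p x x′ y} → StarMove p x x′ → Independent x y → Independent x′ y
independent-step (leafMove m) (xy , yx) =
  (λ c → xy (proj₂ (leafMove-reflects-centre m c))) , λ {p} c → restrict-leafMove p m (yx c)
independent-step (centreMove m) _ =
  (λ c → contradiction c (centreMove-target m)) , λ {p} _ → restrict-centreMove p m

data Separated : State → Set where
  separated : ∀ {x y z} → Independent y x → Independent y z → Separated ⟪ x , y , z ⟫

-- The middle star stands apart so that the two ends are already grouped, as `hot-pair#` and
-- `hot-centre-value` need them.
total : State → Game
total ⟪ x , y , z ⟫ = val y ⊕ (val x ⊕ val z)

separated-move : ∀ {p st st′} → Separated st → Move p st st′ → Separated st′ × total st′ ∈ options p (total st)
separated-move {p} (separated yx yz) (leafᵃ m) =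
  separated (swap (independent-step (leafMove m) (swap yx))) yz ,
  ⊕-onʳ p _ _ (⊕-onˡ p _ _ (val-option⁺ (leafMove m)))
separated-move {p} (separated yx yz) (leafᵇ m) =
  separated (independent-step (leafMove m) yx) (independent-step (leafMove m) yz) ,
  ⊕-onˡ p _ _ (val-option⁺ (leafMove m))
separated-move {p} (separated yx yz) (leafᶜ m) =
  separated yx (swap (independent-step (leafMove m) (swap yz))) ,
  ⊕-onʳ p _ _ (⊕-onʳ p _ _ (val-option⁺ (leafMove m)))
separated-move {p} (separated yx yz) (centreᵃ m) rewrite proj₂ yx m =
  separated (swap (independent-step (centreMove m) (swap yx))) yz ,
  ⊕-onʳ p _ _ (⊕-onˡ p _ _ (val-option⁺ (centreMove m)))
separated-move {p} (separated yx yz) (centreᵇ m) rewrite proj₁ yx m | proj₁ yz m =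
  separated (independent-step (centreMove m) yx) (independent-step (centreMove m) yz) ,
  ⊕-onˡ p _ _ (val-option⁺ (centreMove m))
separated-move {p} (separated yx yz) (centreᶜ m) rewrite proj₂ yz m =
  separated yx (swap (independent-step (centreMove m) (swap yz))) ,
  ⊕-onʳ p _ _ (⊕-onʳ p _ _ (val-option⁺ (centreMove m)))

starMoveᵃ : ∀ {p x x′ y z} → Independent y x → StarMove p x x′ → Move p ⟪ x , y , z ⟫ ⟪ x′ , y , z ⟫
starMoveᵃ _ (leafMove m) = leafᵃ m
starMoveᵃ {y = y} yx (centreMove m) = subst (λ w → Move _ _ ⟪ _ , w , _ ⟫) (proj₂ yx m) (centreᵃ m)

starMoveᵇ : ∀ {p x y y′ z} → Independent y x → Independent y z → StarMove p y y′ →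
            Move p ⟪ x , y , z ⟫ ⟪ x , y′ , z ⟫
starMoveᵇ _ _ (leafMove m) = leafᵇ m
starMoveᵇ yx yz (centreMove m) =
  subst (λ v → Move _ _ ⟪ v , _ , _ ⟫) (proj₁ yx m)
    (subst (λ w → Move _ _ ⟪ _ , _ , w ⟫) (proj₁ yz m) (centreᵇ m))

starMoveᶜ : ∀ {p x y z z′} → Independent y z → StarMove p z z′ → Move p ⟪ x , y , z ⟫ ⟪ x , y , z′ ⟫
starMoveᶜ _ (leafMove m) = leafᶜ m
starMoveᶜ yz (centreMove m) = subst (λ w → Move _ _ ⟪ _ , w , _ ⟫) (proj₂ yz m) (centreᶜ m)

total-option : ∀ p {st X} → Separated st → X ∈ options p (total st) → ∃ λ st′ → Move p st st′ × X ≡ total st′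
total-option p (separated {x} {y} {z} yx yz) X∈ with ⊕-option⁻ p (val y) (val x ⊕ val z) X∈
... | onˡ Y∈ with y′ , m , refl ← val-option⁻ p y Y∈ = _ , starMoveᵇ yx yz m , refl
... | onʳ Y∈ with ⊕-option⁻ p (val x) (val z) Y∈
...   | onˡ Z∈ with x′ , m , refl ← val-option⁻ p x Z∈ = _ , starMoveᵃ yx m , refl
...   | onʳ Z∈ with z′ , m , refl ← val-option⁻ p z Z∈ = _ , starMoveᶜ yz m , refl

separated-value′ : ∀ {st G} → Wf G → Separated st → Realises st G → G ≈ total st
separated-value′ (wf g) sep r = ≈-byOptions
  (λ p X∈ → let _ , move , r′ = option⇒ r p X∈ ; sep′ , T∈ = separated-move sep move
            in _ , T∈ , separated-value′ (g p X∈) sep′ r′)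
  (λ p T∈ → let st′ , move , eq = total-option p sep T∈ ; X , X∈ , r′ = move⇒ r p move
            in X , X∈ , ≈-trans (≈-reflexive eq)
                                (≈-sym (separated-value′ (g p X∈) (proj₁ (separated-move sep move)) r′)))

separated-value : ∀ {st G} → Separated st → Realises st G → G ≈ total st
separated-value {G = G} = separated-value′ (wellFounded G)

-- Comparing numbers

≈-≼-trans : ∀ {G H K} → G ≈ H → H ≼ K → G ≼ K
≈-≼-trans (p , _) = ≼-trans p

≼-≈-trans : ∀ {G H K} → G ≼ H → H ≈ K → G ≼ K
≼-≈-trans p (q , _) = ≼-trans p q

int-⊕ : ∀ m n → int m ⊕ int n ≈ int (m + n)
int-⊕ zero    n = ⊕-identityˡ (int n)
int-⊕ (suc m) n = ≈-byOptions
  (λ { Left X∈ → _ , here refl , option n (⊕-option⁻ Left (int (suc m)) (int n) X∈)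
     ; Right X∈ → contradiction (⊕-option⁻ Right (int (suc m)) (int n) X∈) (none n) })
  (λ { Left (here refl) → _ , ⊕-onˡ Left (int (suc m)) (int n) (here refl) , ≈-sym (int-⊕ m n) })
  where
  option : ∀ n {X} → ⊕-Option Left (int (suc m)) (int n) X → X ≈ int (m + n)
  option n       (onˡ (here refl)) = int-⊕ m n
  option (suc n) (onʳ (here refl)) =
    ≈-trans (int-⊕ (suc m) n) (≈-reflexive (cong int (sym (+-suc m n))))
  none : ∀ n {X} → ¬ ⊕-Option Right (int (suc m)) (int n) X
  none zero    (onʳ ())
  none (suc n) (onʳ ())

s-⊕ : ∀ j k → s j ⊕ s k ≈ s (j + k)
s-⊕ zero          k             = ⊕-identityˡ (s k)
s-⊕ (suc (suc j)) k             = s-⊕ j k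
s-⊕ (suc zero)    zero          = ⊕-identityʳ star
s-⊕ (suc zero)    (suc zero)    = ⊕-inverseʳ star
s-⊕ (suc zero)    (suc (suc k)) = s-⊕ (suc zero) k

neg-s : ∀ j → neg (s j) ≡ s j
neg-s zero          = refl
neg-s (suc zero)    = refl
neg-s (suc (suc j)) = neg-s j

s-period : ∀ j k → s (j + (j + k)) ≡ s k
s-period zero    k = refl
s-period (suc j) k rewrite +-suc j (j + k) = s-period j k

-- 0 and * are confused with each other, so `⧏` holds in both directions.
s-alternates : ∀ j → s j ⧏ s (suc j)
s-alternates zero          = viaˡ (here refl) (≼-refl _)
s-alternates (suc zero)    = viaʳ (here refl) (≼-refl _)
s-alternates (suc (suc j)) = s-alternates j

s-option : ∀ p j {X} → X ∈ options p (s j) → X ≡ int 0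
s-option p     (suc (suc j)) X∈          = s-option p j X∈
s-option Left  (suc zero)    (here refl) = refl
s-option Right (suc zero)    (here refl) = refl
s-option Left  zero          ()
s-option Right zero          ()

0≼int : ∀ d → int 0 ≼ int d
0≼int zero    = ≼-refl _
0≼int (suc d) = le (λ ()) λ ()

0⧏int+s : ∀ d j → int 0 ⧏ int (suc d) ⊕ s j
0⧏int+s d zero          = viaˡ (⊕-onˡ Left (int (suc d)) (int 0) (here refl)) (≼-≈-trans (0≼int d) (≈-sym (⊕-identityʳ _)))
0⧏int+s d (suc zero)    = viaˡ (⊕-onʳ Left (int (suc d)) star (here refl)) (≼-≈-trans (0≼int (suc d)) (≈-sym (⊕-identityʳ _)))
0⧏int+s d (suc (suc j)) = 0⧏int+s d j

0≼int+s : ∀ d j → int 0 ≼ int (suc d) ⊕ s j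
0≼int+s d j = le (λ ()) (λ Y∈ → reply d (⊕-option⁻ Right (int (suc d)) (s j) Y∈))
  where
  reply : ∀ d {Y} → ⊕-Option Right (int (suc d)) (s j) Y → int 0 ⧏ Y
  reply d (onʳ Y∈) with refl ← s-option Right j Y∈ = 0⧏int+s d 0

-- The number l − r, plus * when j is odd.
number : (l r j : ℕ) → Game
number l r j = int l ⊕ s j ⊕ neg (int r)

-- _≈_ unfolds, so Agda cannot infer l, r and j from the equivalence itself.
data IsNumber (G : Game) (l r j : ℕ) : Set where
  is : G ≈ number l r j → IsNumber G l r j

int# : ∀ m → IsNumber (int m) m 0 0
int# m = is (≈-sym (≈-trans (⊕-identityʳ _) (⊕-identityʳ _)))

s# : ∀ j → IsNumber (s j) 0 0 j
s# j = is (≈-sym (≈-trans (⊕-identityʳ _) (⊕-identityˡ _)))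

+s# : ∀ m j → IsNumber (m +s j) m 0 j
+s# m j = is (≈-trans (proj₂ (+s-canonicalForm m j)) (≈-sym (⊕-identityʳ _)))

infixl 6 _⊞_

-- The pair l, r is a formal difference, so triples add componentwise without subtraction. They are
-- never normalised; the comparison lemmas turn them into equations for the ring solver.
_⊞_ : ∀ {G H l r j l′ r′ j′} → IsNumber G l r j → IsNumber H l′ r′ j′ →
      IsNumber (G ⊕ H) (l + l′) (r + r′) (j + j′)
_⊞_ {l = l} {r} {j} {l′} {r′} {j′} (is G≈) (is H≈) = is
  (≈-trans (⊕-cong G≈ H≈)
  (≈-trans (interchange _ _ _ _)
    (⊕-cong (≈-trans (interchange _ _ _ _) (⊕-cong (int-⊕ l l′) (s-⊕ j j′)))
            (≈-trans (⁻¹-∙-comm _ _) (neg-cong (int-⊕ r r′))))))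

neg# : ∀ {G l r j} → IsNumber G l r j → IsNumber (neg G) r l j
neg# {l = l} {r} {j} (is G≈) = is
  (≈-trans (neg-cong G≈)
  (≈-trans (≈-sym (⁻¹-∙-comm _ _))
  (≈-trans (⊕-cong (≈-sym (⁻¹-∙-comm _ _)) (≈-reflexive (neg-involutive (int r))))
  (≈-trans (⊕-comm _ _)
  (≈-trans (⊕-cong ≈-refl (≈-trans (⊕-comm _ _) (⊕-cong (≈-reflexive (neg-s j)) ≈-refl)))
           (≈-sym (⊕-assoc _ _ _)))))))

≈# : ∀ {G H l r j} → G ≈ H → IsNumber H l r j → IsNumber G l r j
≈# G≈H (is H≈) = is (≈-trans G≈H H≈)

-- Adding k - k = 0. Comparisons use it to give both sides the same negative part.
number-shift : ∀ l r j k → number l r j ≈ number (l + k) (r + k) j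
number-shift l r j k =
  ≈-trans (≈-sym (⊕-identityʳ _))
  (≈-trans (⊕-cong ≈-refl (≈-sym (⊕-inverseʳ (int k))))
  (≈-trans (interchange _ _ _ _)
    (⊕-cong (≈-trans (⊕-assoc _ _ _) (≈-trans (⊕-cong ≈-refl (⊕-comm _ _))
              (≈-trans (≈-sym (⊕-assoc _ _ _)) (⊕-cong (int-⊕ l k) ≈-refl))))
            (≈-trans (⁻¹-∙-comm _ _) (neg-cong (int-⊕ r k))))))

-- Writes the larger of two numbers as the smaller plus a positive remainder. The nimber s (j + j′)
-- of the remainder replaces s j by s j′, because the two copies of s j cancel.
int+s-split : ∀ l d j j′ → (int (suc d) ⊕ s (j + j′)) ⊕ (int l ⊕ s j) ≈ int (suc (l + d)) ⊕ s j′
int+s-split l d j j′ = ≈-trans (interchange _ _ _ _)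
  (⊕-cong (≈-trans (int-⊕ (suc d) l) (≈-reflexive (cong (λ k → int (suc k)) (+-comm d l))))
          (≈-trans (⊕-comm _ _) (≈-trans (s-⊕ j (j + j′)) (≈-reflexive (s-period j j′)))))

-- Here and below, d is the slack in l − r ≤ l′ − r′ or l − r < l′ − r′.
number-≼-≡ : ∀ {G H l r j l′ r′ j′} d → IsNumber G l r j → IsNumber H l′ r′ j′ →
             s j ≡ s j′ → l + r′ + d ≡ l′ + r → G ≼ H
number-≼-≡ {l = l} {r} {j} {l′} {r′} {j′} d (is G≈) (is H≈) sj≡ eq =
  ≈-≼-trans (≈-trans G≈ (number-shift l r j r′))
  (≼-≈-trans (⊕-mono (⊕-mono grow (proj₁ (≈-reflexive sj≡)))
                     (proj₁ (≈-reflexive (cong (λ k → neg (int k)) (+-comm r r′)))))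
             (≈-sym (≈-trans H≈ (number-shift l′ r′ j′ r))))
  where
  grow : int (l + r′) ≼ int (l′ + r)
  grow = ≈-≼-trans (≈-sym (⊕-identityʳ _))
           (≼-≈-trans (⊕-monoʳ _ (0≼int d)) (≈-trans (int-⊕ (l + r′) d) (≈-reflexive (cong int eq))))

number-≈ : ∀ {G H l r j l′ r′ j′} → IsNumber G l r j → IsNumber H l′ r′ j′ →
           s j ≡ s j′ → l + r′ ≡ l′ + r → G ≈ H
number-≈ {l = l} {r} {l′ = l′} {r′} G# H# sj≡ eq =
  number-≼-≡ 0 G# H# sj≡ (trans (+-identityʳ (l + r′)) eq) ,
  number-≼-≡ 0 H# G# (sym sj≡) (trans (+-identityʳ (l′ + r)) (sym eq))

-- A gap of at least 1 outweighs the nimbers, so j and j′ are arbitrary here. The gap is d + 1.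
number-< : ∀ {G H l r j l′ r′ j′} d → IsNumber G l r j → IsNumber H l′ r′ j′ →
           suc (l + r′ + d) ≡ l′ + r → G ≼ H × G ⧏ H
number-< {l = l} {r} {j} {l′} {r′} {j′} d (is G≈) (is H≈) eq =
  ≈-≼-trans G≈′ (≼-≈-trans (⊕-monoˡ _ (⊕-monoˡ _ (0≼int+s d (j + j′)))) (≈-sym H≈′)) ,
  ≼-⧏-trans (proj₁ G≈′) (⧏-≼-trans (mono (mono (0⧏int+s d (j + j′)))) (proj₂ H≈′))
  where
  mono : ∀ {G H K} → G ⧏ H → G ⊕ K ⧏ H ⊕ K
  mono = ⊕-monoˡ-⧏ (wellFounded _)
  G≈′ : _ ≈ int 0 ⊕ (int (l + r′) ⊕ s j) ⊕ neg (int (r + r′))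
  G≈′ = ≈-trans G≈ (≈-trans (number-shift l r j r′) (⊕-cong (≈-sym (⊕-identityˡ _)) ≈-refl))
  H≈′ : _ ≈ int (suc d) ⊕ s (j + j′) ⊕ (int (l + r′) ⊕ s j) ⊕ neg (int (r + r′))
  H≈′ = ≈-trans H≈ (≈-trans (number-shift l′ r′ j′ r)
          (⊕-cong (≈-trans (⊕-cong (≈-reflexive (cong int (sym eq))) ≈-refl)
                           (≈-sym (int+s-split (l + r′) d j j′)))
                  (≈-reflexive (cong (λ k → neg (int k)) (+-comm r′ r)))))

number-≼ : ∀ {G H l r j l′ r′ j′} d → IsNumber G l r j → IsNumber H l′ r′ j′ →
           suc (l + r′ + d) ≡ l′ + r → G ≼ H
number-≼ d G# H# eq = proj₁ (number-< d G# H# eq)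

number-⧏ : ∀ {G H l r j l′ r′ j′} d → IsNumber G l r j → IsNumber H l′ r′ j′ →
           suc (l + r′ + d) ≡ l′ + r → G ⧏ H
number-⧏ d G# H# eq = proj₂ (number-< d G# H# eq)

-- From colourings to triples of stars

isFree : Maybe Player → ℕ
isFree nothing  = 1
isFree (just _) = 0

countFree : ∀ {m} → (Fin m → Maybe Player) → ℕ
countFree {zero}  f = 0
countFree {suc m} f = isFree (f zero) + countFree (λ i → f (suc i))

countFree-cong : ∀ {m} {f g : Fin m → Maybe Player} → (∀ i → f i ≡ g i) → countFree f ≡ countFree g
countFree-cong {zero}  _   = refl
countFree-cong {suc m} f≗g = cong₂ _+_ (cong isFree (f≗g zero)) (countFree-cong (λ i → f≗g (suc i)))

countFree-all : ∀ {m} {f : Fin m → Maybe Player} → (∀ i → f i ≡ nothing) → countFree f ≡ m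
countFree-all {zero}  _ = refl
countFree-all {suc m} h rewrite h zero = cong suc (countFree-all (λ i → h (suc i)))

countFree-fill : ∀ {m} {f g : Fin m → Maybe Player} {q} i → f i ≡ nothing → g i ≡ just q →
                 (∀ j → j ≢ i → g j ≡ f j) → countFree f ≡ suc (countFree g)
countFree-fill zero fi gi same rewrite fi | gi = cong suc (countFree-cong (λ j → sym (same (suc j) λ ())))
countFree-fill {f = f} {g} (suc i) fi gi same =
  trans (cong₂ _+_ (cong isFree (sym (same zero λ ())))
                   (countFree-fill i fi gi (λ j j≢i → same (suc j) (λ eq → j≢i (Fin.suc-injective eq)))))
        (+-suc (isFree (g zero)) _)

free-exists : ∀ {m u} {f : Fin m → Maybe Player} → countFree f ≡ suc u → ∃ λ i → f i ≡ nothing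
free-exists {suc m} {f = f} eq with f zero in f0
... | nothing = zero , f0
... | just _  = let i , fi = free-exists eq in suc i , fi

-- The number of uncoloured vertices as a measure of play

starSize : Star → ℕ
starSize (blank _ _ u)  = suc u
starSize (coloured _ u) = u

size : State → ℕ
size ⟪ x , y , z ⟫ = starSize x + (starSize y + starSize z)

starSize-restrict : ∀ s x → starSize (restrict s x) ≡ starSize x
starSize-restrict Left  (blank _ _ _)  = refl
starSize-restrict Right (blank _ _ _)  = refl
starSize-restrict Left  (coloured _ _) = refl
starSize-restrict Right (coloured _ _) = refl

starSize-leafMove : ∀ {s x x′} → LeafMove s x x′ → starSize x ≡ suc (starSize x′)
starSize-leafMove {Left}  onOpen = refl
starSize-leafMove {Right} onOpen = refl
starSize-leafMove onOwn = refl

starSize-centreMove : ∀ {s x x′} → CentreMove s x x′ → starSize x ≡ suc (starSize x′)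
starSize-centreMove byLeft  = refl
starSize-centreMove byRight = refl

size-move : ∀ {s st st′} → Move s st st′ → size st ≡ suc (size st′)
size-move (leafᵃ m) = cong (_+ _) (starSize-leafMove m)
size-move {st = ⟪ x , _ , z ⟫} (leafᵇ m) rewrite starSize-leafMove m = +-suc (starSize x) _
size-move {st = ⟪ x , y , _ ⟫} {⟪ _ , _ , z′ ⟫} (leafᶜ m)
  rewrite starSize-leafMove m | +-suc (starSize y) (starSize z′) = +-suc (starSize x) _
size-move {s} (centreᵃ {y = y} m) rewrite starSize-restrict s y = cong (_+ _) (starSize-centreMove m)
size-move {s} (centreᵇ {x} {z = z} m)
  rewrite starSize-restrict s x | starSize-restrict s z | starSize-centreMove m = +-suc (starSize x) _
size-move {s} (centreᶜ {x} {y} {z} {z′} m)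
  rewrite starSize-restrict s y | starSize-centreMove m | +-suc (starSize y) (starSize z′) = +-suc (starSize x) _

reflects-map : ∀ {A B : Set} {d} → (A → B) → (B → A) → Reflects A d → Reflects B d
reflects-map f g (ofʸ x)  = ofʸ (f x)
reflects-map f g (ofⁿ ¬x) = ofⁿ λ y → ¬x (g y)

restrict-coloured : ∀ s t u → restrict s (coloured t u) ≡ coloured t u
restrict-coloured Left  _ _ = refl
restrict-coloured Right _ _ = refl

module _ {p q r : ℕ} where

  Γ : FiniteGraph
  Γ = caterpillar p q r

  open FiniteGraph Γ using (Adj; _≟_; complete; vertices)
  open Snort Γ

  V : Set
  V = CatVertex p q r

  SpineOk : Colouring → Spine → Player → Set
  SpineOk σ x s = ∀ w → Adj (spine x) w → σ w ≢ just (opponent s)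

  freeLeaves : Colouring → Spine → ℕ
  freeLeaves σ x = countFree (λ i → σ (leaf x i))

  -- The colours of used leaves are forgotten. They matter only while the spine vertex is
  -- uncoloured, and then only through the two flags, which say whether some neighbour already
  -- carries the opposite colour.
  data RepStar (σ : Colouring) (x : Spine) : Star → Set where
    isOpen : ∀ {l r u} → σ (spine x) ≡ nothing →
             Reflects (SpineOk σ x Left) l → Reflects (SpineOk σ x Right) r →
             freeLeaves σ x ≡ u → RepStar σ x (blank l r u)
    isColoured : ∀ {s u} → σ (spine x) ≡ just s → freeLeaves σ x ≡ u → RepStar σ x (coloured s u)

  data Rep (σ : Colouring) : State → Set where
    rep : ∀ {x y z} → RepStar σ a x → RepStar σ b y → RepStar σ c z → Rep σ ⟪ x , y , z ⟫

  colour-at : ∀ s v σ → colour s v σ v ≡ just s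
  colour-at s v σ with v ≟ v
  ... | yes _   = refl
  ... | no v≢v = contradiction refl v≢v

  colour-off : ∀ s v σ w → w ≢ v → colour s v σ w ≡ σ w
  colour-off s v σ w w≢v with w ≟ v
  ... | yes w≡v = contradiction w≡v w≢v
  ... | no _    = refl

  opponent≢ : ∀ s → s ≢ opponent s
  opponent≢ Left  ()
  opponent≢ Right ()

  module _ (s : Player) (v : V) (σ : Colouring) (free : σ v ≡ nothing) where

    σ′ : Colouring
    σ′ = colour s v σ

    -- Colouring takes rights away and grants none: before the move v was uncoloured and hence no
    -- obstacle.
    spineOk⁻ : ∀ {x t} → SpineOk σ′ x t → SpineOk σ x t
    spineOk⁻ ok w adj eq with w ≟ v
    ... | yes refl = contradiction (trans (sym free) eq) λ ()
    ... | no w≢v  = ok w adj (trans (colour-off s v σ w w≢v) eq)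

    spineOk-own : ∀ {x} → SpineOk σ x s → SpineOk σ′ x s
    spineOk-own ok w adj eq with w ≟ v
    ... | yes refl = opponent≢ s (just-injective eq)
    ... | no _     = ok w adj eq

    spineOk-far : ∀ {x t} → ¬ Adj (spine x) v → SpineOk σ x t → SpineOk σ′ x t
    spineOk-far far ok w adj eq with w ≟ v
    ... | yes refl = far adj
    ... | no _     = ok w adj eq

    spineOk-opponent : ∀ {x t} → opponent t ≡ s → Adj (spine x) v → ¬ SpineOk σ′ x t
    spineOk-opponent refl adj ok = ok v adj (colour-at s v σ)

    freeLeaves-off : ∀ {x} → (∀ i → leaf x i ≢ v) → freeLeaves σ′ x ≡ freeLeaves σ x
    freeLeaves-off v∉ = countFree-cong λ i → colour-off s v σ _ (v∉ i)

    unaffected : ∀ {x S} → spine x ≢ v → ¬ Adj (spine x) v → (∀ i → leaf x i ≢ v) →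
                 RepStar σ x S → RepStar σ′ x S
    unaffected x≢ far v∉ (isOpen e l r u) =
      isOpen (trans (colour-off s v σ _ x≢) e) (reflects-map (spineOk-far far) spineOk⁻ l)
             (reflects-map (spineOk-far far) spineOk⁻ r) (trans (freeLeaves-off v∉) u)
    unaffected x≢ far v∉ (isColoured e u) =
      isColoured (trans (colour-off s v σ _ x≢) e) (trans (freeLeaves-off v∉) u)

  -- Shared by the two ways in which an uncoloured spine vertex loses a right: a coloured leaf of
  -- its own and a coloured spine neighbour. Only the leaf count `u′` after the move tells them
  -- apart.
  restricted : ∀ s v σ {x l r u u′} → σ v ≡ nothing → spine x ≢ v → Adj (spine x) v →
               freeLeaves (colour s v σ) x ≡ u′ →
               RepStar σ x (blank l r u) → RepStar (colour s v σ) x (restrict s (blank l r u′))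
  restricted Left v σ free x≢ adj u (isOpen e l _ _) =
    isOpen (trans (colour-off Left v σ _ x≢) e)
           (reflects-map (spineOk-own Left v σ free) (spineOk⁻ Left v σ free) l)
           (ofⁿ (spineOk-opponent Left v σ free refl adj)) u
  restricted Right v σ free x≢ adj u (isOpen e _ r _) =
    isOpen (trans (colour-off Right v σ _ x≢) e) (ofⁿ (spineOk-opponent Right v σ free refl adj))
           (reflects-map (spineOk-own Right v σ free) (spineOk⁻ Right v σ free) r) u

  neighbour : ∀ s v σ {x S} → σ v ≡ nothing → spine x ≢ v → Adj (spine x) v → (∀ i → leaf x i ≢ v) →
              RepStar σ x S → RepStar (colour s v σ) x (restrict s S)
  neighbour s v σ free x≢ adj v∉ R@(isOpen _ _ _ u) =
    restricted s v σ free x≢ adj (trans (freeLeaves-off s v σ free v∉) u) R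
  neighbour s v σ free x≢ adj v∉ (isColoured e u) =
    subst (RepStar _ _) (sym (restrict-coloured s _ _))
      (isColoured (trans (colour-off s v σ _ x≢) e) (trans (freeLeaves-off s v σ free v∉) u))

  leaf-injective : ∀ {x i j} → _≡_ {A = V} (leaf x i) (leaf x j) → i ≡ j
  leaf-injective refl = refl

  freeLeaves-at : ∀ s {x} i σ → σ (leaf x i) ≡ nothing → freeLeaves σ x ≡ suc (freeLeaves (colour s (leaf x i) σ) x)
  freeLeaves-at s {x} i σ free = countFree-fill i free (colour-at s (leaf x i) σ)
    λ j j≢i → colour-off s (leaf x i) σ (leaf x j) λ eq → j≢i (leaf-injective eq)

  afterLeaf : ∀ s {x} i σ {S S′} → σ (leaf x i) ≡ nothing → LeafMove s S S′ →
              RepStar σ x S → RepStar (colour s (leaf x i) σ) x S′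
  afterLeaf s {x} i σ free onOpen R@(isOpen _ _ _ u) =
    restricted s _ σ free (λ ()) (bwd (pendant x i)) (suc-injective (trans (sym (freeLeaves-at s i σ free)) u)) R
  afterLeaf s {x} i σ free onOwn (isColoured e u) =
    isColoured (trans (colour-off s (leaf x i) σ (spine x) λ ()) e)
               (suc-injective (trans (sym (freeLeaves-at s i σ free)) u))

  afterCentre : ∀ s x σ {S S′} → CentreMove s S S′ → RepStar σ x S → RepStar (colour s (spine x) σ) x S′
  afterCentre s x σ byLeft (isOpen e _ _ u) =
    isColoured (colour-at s (spine x) σ) (trans (freeLeaves-off s _ σ e {x} λ _ ()) u)
  afterCentre s x σ byRight (isOpen e _ _ u) =
    isColoured (colour-at s (spine x) σ) (trans (freeLeaves-off s _ σ e {x} λ _ ()) u)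

  no-free : ∀ {x} i σ → σ (leaf x i) ≡ nothing → freeLeaves σ x ≢ 0
  -- The colour Left is arbitrary: hypothetically colouring the leaf shows that the count is a
  -- successor.
  no-free i σ free eq with () ← trans (sym eq) (freeLeaves-at Left i σ free)

  legal⇒leafMove : ∀ {s x σ S} i → RepStar σ x S → Legal s σ (leaf x i) → ∃ (LeafMove s S)
  legal⇒leafMove {σ = σ} i (isOpen {u = zero}  _ _ _ u) (free , _) = contradiction u (no-free i σ free)
  legal⇒leafMove i (isOpen {u = suc _} _ _ _ u) _ = _ , onOpen
  legal⇒leafMove {σ = σ} i (isColoured {u = zero} _ u) (free , _) = contradiction u (no-free i σ free)
  legal⇒leafMove {Left}  i (isColoured {Left}  {suc _} _ _) _ = _ , onOwn
  legal⇒leafMove {Right} i (isColoured {Right} {suc _} _ _) _ = _ , onOwn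
  legal⇒leafMove {Left}  {x} i (isColoured {Right} {suc _} e _) (_ , ok) =
    contradiction e (ok (spine x) (fwd (pendant x i)))
  legal⇒leafMove {Right} {x} i (isColoured {Left} {suc _} e _) (_ , ok) =
    contradiction e (ok (spine x) (fwd (pendant x i)))

  leaf-legal : ∀ {s x i} σ → σ (leaf x i) ≡ nothing → σ (spine x) ≢ just (opponent s) → Legal s σ (leaf x i)
  leaf-legal σ free ok = free , λ { _ (fwd (pendant _ _)) → ok ; _ (bwd ()) }

  leafMove⇒legal : ∀ {s x σ S S′} → RepStar σ x S → LeafMove s S S′ → ∃ λ i → Legal s σ (leaf x i)
  leafMove⇒legal {σ = σ} (isOpen e _ _ u) onOpen =
    let i , free = free-exists u in i , leaf-legal σ free λ eq → contradiction (trans (sym e) eq) λ ()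
  leafMove⇒legal {s} {σ = σ} (isColoured e u) onOwn =
    let i , free = free-exists u
    in i , leaf-legal σ free λ eq → opponent≢ s (just-injective (trans (sym e) eq))

  legal⇒centreMove : ∀ {s x σ S} → RepStar σ x S → Legal s σ (spine x) → ∃ (CentreMove s S)
  legal⇒centreMove {Left}  (isOpen _ (ofʸ _) _ _)   _        = _ , byLeft
  legal⇒centreMove {Right} (isOpen _ _ (ofʸ _) _)   _        = _ , byRight
  legal⇒centreMove {Left}  (isOpen _ (ofⁿ ¬ok) _ _) (_ , ok) = contradiction ok ¬ok
  legal⇒centreMove {Right} (isOpen _ _ (ofⁿ ¬ok) _) (_ , ok) = contradiction ok ¬ok
  legal⇒centreMove (isColoured e _) (free , _) = contradiction (trans (sym free) e) λ ()

  centreMove⇒legal : ∀ {s x σ S S′} → RepStar σ x S → CentreMove s S S′ → Legal s σ (spine x)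
  centreMove⇒legal (isOpen e (ofʸ ok) _ _) byLeft  = e , ok
  centreMove⇒legal (isOpen e _ (ofʸ ok) _) byRight = e , ok

  afterLeafᵃ : ∀ {s σ x x′ y z i} → Rep σ ⟪ x , y , z ⟫ → σ (leaf a i) ≡ nothing → LeafMove s x x′ →
               Rep (colour s (leaf a i) σ) ⟪ x′ , y , z ⟫
  afterLeafᵃ {s} {σ} {i = i} (rep X Y Z) free m = rep (afterLeaf s i σ free m X)
    (unaffected s _ σ free (λ ()) (λ { (fwd ()) ; (bwd ()) }) (λ _ ()) Y)
    (unaffected s _ σ free (λ ()) (λ { (fwd ()) ; (bwd ()) }) (λ _ ()) Z)

  afterLeafᵇ : ∀ {s σ x y y′ z i} → Rep σ ⟪ x , y , z ⟫ → σ (leaf b i) ≡ nothing → LeafMove s y y′ →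
               Rep (colour s (leaf b i) σ) ⟪ x , y′ , z ⟫
  afterLeafᵇ {s} {σ} {i = i} (rep X Y Z) free m = rep
    (unaffected s _ σ free (λ ()) (λ { (fwd ()) ; (bwd ()) }) (λ _ ()) X) (afterLeaf s i σ free m Y)
    (unaffected s _ σ free (λ ()) (λ { (fwd ()) ; (bwd ()) }) (λ _ ()) Z)

  afterLeafᶜ : ∀ {s σ x y z z′ i} → Rep σ ⟪ x , y , z ⟫ → σ (leaf c i) ≡ nothing → LeafMove s z z′ →
               Rep (colour s (leaf c i) σ) ⟪ x , y , z′ ⟫
  afterLeafᶜ {s} {σ} {i = i} (rep X Y Z) free m = rep
    (unaffected s _ σ free (λ ()) (λ { (fwd ()) ; (bwd ()) }) (λ _ ()) X)
    (unaffected s _ σ free (λ ()) (λ { (fwd ()) ; (bwd ()) }) (λ _ ()) Y) (afterLeaf s i σ free m Z)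

  afterCentreᵃ : ∀ {s σ x x′ y z} → Rep σ ⟪ x , y , z ⟫ → σ (spine a) ≡ nothing → CentreMove s x x′ →
                 Rep (colour s (spine a) σ) ⟪ x′ , restrict s y , z ⟫
  afterCentreᵃ {s} {σ} (rep X Y Z) free m = rep (afterCentre s a σ m X)
    (neighbour s _ σ free (λ ()) (bwd ab) (λ _ ()) Y)
    (unaffected s _ σ free (λ ()) (λ { (fwd ()) ; (bwd ()) }) (λ _ ()) Z)

  afterCentreᵇ : ∀ {s σ x y y′ z} → Rep σ ⟪ x , y , z ⟫ → σ (spine b) ≡ nothing → CentreMove s y y′ →
                 Rep (colour s (spine b) σ) ⟪ restrict s x , y′ , restrict s z ⟫
  afterCentreᵇ {s} {σ} (rep X Y Z) free m = rep (neighbour s _ σ free (λ ()) (fwd ab) (λ _ ()) X)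
    (afterCentre s b σ m Y) (neighbour s _ σ free (λ ()) (bwd bc) (λ _ ()) Z)

  afterCentreᶜ : ∀ {s σ x y z z′} → Rep σ ⟪ x , y , z ⟫ → σ (spine c) ≡ nothing → CentreMove s z z′ →
                 Rep (colour s (spine c) σ) ⟪ x , restrict s y , z′ ⟫
  afterCentreᶜ {s} {σ} (rep X Y Z) free m = rep (unaffected s _ σ free (λ ()) (λ { (fwd ()) ; (bwd ()) }) (λ _ ()) X)
    (neighbour s _ σ free (λ ()) (fwd bc) (λ _ ()) Y) (afterCentre s c σ m Z)

  legal⇒move : ∀ {s σ st} v → Rep σ st → Legal s σ v → ∃ λ st′ → Move s st st′ × Rep (colour s v σ) st′
  legal⇒move (leaf a i) R@(rep X _ _) L = let _ , m = legal⇒leafMove i X L in _ , leafᵃ m , afterLeafᵃ R (proj₁ L) m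
  legal⇒move (leaf b i) R@(rep _ Y _) L = let _ , m = legal⇒leafMove i Y L in _ , leafᵇ m , afterLeafᵇ R (proj₁ L) m
  legal⇒move (leaf c i) R@(rep _ _ Z) L = let _ , m = legal⇒leafMove i Z L in _ , leafᶜ m , afterLeafᶜ R (proj₁ L) m
  legal⇒move (spine a)  R@(rep X _ _) L = let _ , m = legal⇒centreMove X L in _ , centreᵃ m , afterCentreᵃ R (proj₁ L) m
  legal⇒move (spine b)  R@(rep _ Y _) L = let _ , m = legal⇒centreMove Y L in _ , centreᵇ m , afterCentreᵇ R (proj₁ L) m
  legal⇒move (spine c)  R@(rep _ _ Z) L = let _ , m = legal⇒centreMove Z L in _ , centreᶜ m , afterCentreᶜ R (proj₁ L) m

  move⇒legal : ∀ {s σ st st′} → Rep σ st → Move s st st′ → ∃ λ v → Legal s σ v × Rep (colour s v σ) st′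
  move⇒legal R@(rep X _ _) (leafᵃ m)   = let _ , L = leafMove⇒legal X m in _ , L , afterLeafᵃ R (proj₁ L) m
  move⇒legal R@(rep _ Y _) (leafᵇ m)   = let _ , L = leafMove⇒legal Y m in _ , L , afterLeafᵇ R (proj₁ L) m
  move⇒legal R@(rep _ _ Z) (leafᶜ m)   = let _ , L = leafMove⇒legal Z m in _ , L , afterLeafᶜ R (proj₁ L) m
  move⇒legal R@(rep X _ _) (centreᵃ m) = let L = centreMove⇒legal X m in _ , L , afterCentreᵃ R (proj₁ L) m
  move⇒legal R@(rep _ Y _) (centreᵇ m) = let L = centreMove⇒legal Y m in _ , L , afterCentreᵇ R (proj₁ L) m
  move⇒legal R@(rep _ _ Z) (centreᶜ m) = let L = centreMove⇒legal Z m in _ , L , afterCentreᶜ R (proj₁ L) m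

  play-options : ∀ s k σ →
    options s (play (suc k) σ) ≡ map (λ v → play k (colour s v σ)) (filter (legal? s σ) vertices)
  play-options Left  k σ = refl
  play-options Right k σ = refl

  play-option⁻ : ∀ s k σ {X} → X ∈ options s (play (suc k) σ) → ∃ λ v → Legal s σ v × X ≡ play k (colour s v σ)
  play-option⁻ s k σ X∈ with v , v∈ , eq ← ∈-map⁻ (λ v → play k (colour s v σ)) (subst (_ ∈_) (play-options s k σ) X∈) =
    v , proj₂ (∈-filter⁻ (legal? s σ) {xs = vertices} v∈) , eq

  play-option⁺ : ∀ s k σ {v} → Legal s σ v → play k (colour s v σ) ∈ options s (play (suc k) σ)
  play-option⁺ s k σ {v} L = subst (play k (colour s v σ) ∈_) (sym (play-options s k σ))
    (∈-map⁺ (λ v → play k (colour s v σ)) (∈-filter⁺ (legal? s σ) (complete v) L))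

  -- The bound equals the number of uncoloured vertices, which drops by one with every move. When it
  -- reaches zero the state has no moves either, so the cut-off in `play` loses nothing.
  play-realises : ∀ k {σ st} → k ≡ size st → Rep σ st → Realises st (play k σ)
  play-realises zero k≡ R = realises (λ { Left () ; Right () })
    λ p move → contradiction (trans k≡ (size-move move)) λ ()
  play-realises (suc k) {σ} k≡ R = realises
    (λ p X∈ → let v , L , eq = play-option⁻ p k σ X∈ ; st′ , move , R′ = legal⇒move v R L
              in st′ , move , subst (Realises st′) (sym eq) (play-realises k (suc-injective (trans k≡ (size-move move))) R′))
    (λ p move → let v , L , R′ = move⇒legal R move
                in _ , play-option⁺ p k σ L , play-realises k (suc-injective (trans k≡ (size-move move))) R′)

snort-realises : ∀ p q r → Realises ⟪ blank true true p , blank true true q , blank true true r ⟫ (snort (caterpillar p q r))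
snort-realises p q r = play-realises (length (FiniteGraph.vertices (caterpillar p q r))) number-of-vertices
  (rep (start a) (start b) (start c))
  where
  start : ∀ x → RepStar {p} {q} {r} (λ _ → nothing) x (blank true true (leaves p q r x))
  start x = isOpen refl (ofʸ λ _ _ ()) (ofʸ λ _ _ ()) (countFree-all λ _ → refl)
  block : Spine → List (CatVertex p q r)
  block x = spine x ∷ map (leaf x) (allFin (leaves p q r x))
  length-block : ∀ x → length (block x) ≡ suc (leaves p q r x)
  length-block x = cong suc (trans (length-map (leaf x) (allFin _)) (length-tabulate _))
  number-of-vertices : length (catVertices p q r) ≡ suc p + (suc q + suc r)
  number-of-vertices =
    trans (length-++ (block a)) (cong₂ _+_ (length-block a)
      (trans (length-++ (block b)) (cong₂ _+_ (length-block b)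
        (trans (cong length (++-identityʳ (block c))) (length-block c)))))

-- Values of stars

-- The reflection exchanging a and c. It fixes the starting position, so that Left's moves at c
-- reduce to those at a.
mirror : State → State
mirror ⟪ x , y , z ⟫ = ⟪ z , y , x ⟫

mirror-move : ∀ {p st st′} → Move p st st′ → Move p (mirror st) (mirror st′)
mirror-move (leafᵃ m)   = leafᶜ m
mirror-move (leafᵇ m)   = leafᵇ m
mirror-move (leafᶜ m)   = leafᵃ m
mirror-move (centreᵃ m) = centreᶜ m
mirror-move (centreᵇ m) = centreᵇ m
mirror-move (centreᶜ m) = centreᵃ m

mirror-involutive : ∀ st → mirror (mirror st) ≡ st
mirror-involutive ⟪ x , y , z ⟫ = refl

mirror-realises′ : ∀ {st G} → Wf G → Realises st G → Realises (mirror st) G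
mirror-realises′ {st} (wf g) r = realises
  (λ p X∈ → let _ , move , r′ = option⇒ r p X∈ in _ , mirror-move move , mirror-realises′ (g p X∈) r′)
  (λ p {st′} move →
    let X , X∈ , r′ = move⇒ r p (subst (λ t → Move p t (mirror st′)) (mirror-involutive st) (mirror-move move))
    in X , X∈ , subst (λ t → Realises t X) (mirror-involutive st′) (mirror-realises′ (g p X∈) r′))

mirror-realises : ∀ {st G} → Realises st G → Realises (mirror st) G
mirror-realises {G = G} = mirror-realises′ (wellFounded G)

coloured-independent : ∀ p u x → Independent (coloured p u) x
coloured-independent p u x = (λ ()) , λ { {Left} _ → refl ; {Right} _ → refl }

dead-independent : ∀ u x → Independent (blank false false u) x
dead-independent u x = (λ ()) , λ { {Left} _ → refl ; {Right} _ → refl }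

blue-independent : ∀ u v → Independent (blank true false u) (blank true false v)
blue-independent u v = (λ { byLeft → refl }) , λ { byLeft → refl }

replyʳ : ∀ {st st′ G H} → Realises st G → Move Right st st′ → (∀ {X} → Realises st′ X → X ≼ H) → G ⧏ H
replyʳ r move X≼H = let _ , X∈ , r′ = move⇒ r Right move in viaʳ X∈ (X≼H r′)

replyˡ : ∀ {st st′ G H} → Realises st G → Move Left st st′ → (∀ {X} → Realises st′ X → H ≼ X) → H ⧏ G
replyˡ r move H≼X = let _ , X∈ , r′ = move⇒ r Left move in viaˡ X∈ (H≼X r′)

coloured-centre : ∀ {p u x z} → Separated ⟪ x , coloured p u , z ⟫
coloured-centre = separated (coloured-independent _ _ _) (coloured-independent _ _ _)

dead-centre : ∀ {u x z} → Separated ⟪ x , blank false false u , z ⟫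
dead-centre = separated (dead-independent _ _) (dead-independent _ _)

coloured-ends : ∀ {p q u v y} → Separated ⟪ coloured p u , y , coloured q v ⟫
coloured-ends = separated (swap (coloured-independent _ _ _)) (swap (coloured-independent _ _ _))

switch : Game → Game → Game
switch G H = ⟨ G ∷ [] ∣ H ∷ [] ⟩

switch-mono : ∀ {G G′ H H′} → G ≼ G′ → H ≼ H′ → switch G H ≼ switch G′ H′
switch-mono p q = le (λ { (here refl) → viaˡ (here refl) p }) (λ { (here refl) → viaʳ (here refl) q })

switch-cong : ∀ {G G′ H H′} → G ≈ G′ → H ≈ H′ → switch G H ≈ switch G′ H′
switch-cong (p , p′) (q , q′) = switch-mono p q , switch-mono p′ q′

int-rightless : ∀ i {X} → ¬ X ∈ right (int i)
int-rightless zero    ()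
int-rightless (suc i) ()

switch≼int : ∀ p q → switch (int p) q ≼ int (suc p)
switch≼int p q = le (λ { (here refl) → viaˡ (here refl) (≼-refl _) }) λ ()

-- Number translation. Left's move in i yields at most i + p because {p | q} ≤ p + 1, and Right has
-- no move in i.
switch-shift : ∀ i p q → int i ⊕ switch (int p) q ≈ switch (int (i + p)) (int i ⊕ q)
switch-shift i p q =
  le (λ X∈ → left-option i (⊕-option⁻ Left (int i) _ X∈))
     (λ { (here refl) → viaʳ (⊕-onʳ Right (int i) _ (here refl)) (≼-refl _) }) ,
  le (λ { (here refl) → viaˡ (⊕-onʳ Left (int i) _ (here refl)) (proj₂ (int-⊕ i p)) })
     (λ Y∈ → right-option i (⊕-option⁻ Right (int i) _ Y∈))
  where
  left-option : ∀ i {X} → ⊕-Option Left (int i) (switch (int p) q) X → X ⧏ switch (int (i + p)) (int i ⊕ q)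
  left-option (suc i) (onˡ (here refl)) = viaˡ (here refl)
    (≼-trans (⊕-monoʳ _ (switch≼int p q)) (≼-≈-trans (proj₁ (int-⊕ i (suc p))) (≈-reflexive (cong int (+-suc i p)))))
  left-option i (onʳ (here refl)) = viaˡ (here refl) (proj₁ (int-⊕ i p))
  right-option : ∀ i {Y} → ⊕-Option Right (int i) (switch (int p) q) Y → switch (int (i + p)) (int i ⊕ q) ⧏ Y
  right-option i (onˡ Y∈)          = contradiction Y∈ (int-rightless i)
  right-option i (onʳ (here refl)) = viaʳ (here refl) (≼-refl _)

+s-left≼ : ∀ m j {X} → X ∈ left (m +s j) → X ≼ int m
+s-left≼ (suc m) zero          (here refl) = number-≼ 0 (int# m) (int# (suc m)) (solve (m ∷ []))
+s-left≼ m       (suc zero)    (here refl) = ≼-refl _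
+s-left≼ m       (suc (suc j)) X∈          = +s-left≼ m j X∈

+s-right : ∀ m j {Y} → Y ∈ right (m +s j) → Y ≡ int m
+s-right m zero          Y∈          = contradiction Y∈ (int-rightless m)
+s-right m (suc zero)    (here refl) = refl
+s-right m (suc (suc j)) Y∈          = +s-right m j Y∈

+s≼switch : ∀ m j {G H} → int m ≼ G → m +s j ⧏ H → m +s j ≼ switch G H
+s≼switch m j m≼G m⧏H = le (λ X∈ → viaˡ (here refl) (≼-trans (+s-left≼ m j X∈) m≼G)) (λ { (here refl) → m⧏H })

0+s : ∀ j → 0 +s j ≡ s j
0+s zero          = refl
0+s (suc zero)    = refl
0+s (suc (suc j)) = 0+s j

switch-s : ∀ j → switch (s j) (s j) ≈ s (suc j)
switch-s zero          = ≈-refl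
switch-s (suc zero)    =
  le (λ { (here refl) → viaʳ (here refl) (≼-refl _) }) (λ ()) ,
  le (λ ()) (λ { (here refl) → viaˡ (here refl) (≼-refl _) })
switch-s (suc (suc j)) = switch-s j

dead-value : ∀ u → openStar false false u ≈ s u
dead-value zero    = ≈-refl
dead-value (suc u) = ≈-trans (switch-cong (dead-value u) (dead-value u)) (switch-s u)

-- There are u + 1 uncoloured vertices, hence at most that many moves for Left.
openStar≼int : ∀ l r u → openStar l r u ≼ int (suc u)
openStar≼int l     r zero    = le (λ X∈ → viaˡ (here refl) (option l X∈)) λ ()
  where
  option : ∀ l {X} → X ∈ centreOption l (int 0) → X ≼ int 0
  option true (here refl) = ≼-refl _
openStar≼int l r (suc u) = le (λ { (here refl) → viaˡ (here refl) (openStar≼int l false u)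
                                 ; (there X∈)  → viaˡ (here refl) (option l X∈) }) λ ()
  where
  option : ∀ l {X} → X ∈ centreOption l (int (suc u)) → X ≼ int (suc u)
  option true (here refl) = ≼-refl _

-- The index is one less than the number of leaves.
hot : ℕ → Game
hot u = switch (int (suc u)) (s u)

-- Left's leaf move is dominated: the u + 1 vertices that it leaves are worth at most the u + 1 that
-- the centre secures at once. Right's only move is a leaf, which makes the star dead.
blue-value : ∀ u → openStar true false (suc u) ≈ hot u
blue-value u =
  le (λ { (here refl) → viaˡ (here refl) (openStar≼int true false u)
        ; (there (here refl)) → viaˡ (here refl) (≼-refl _) })
     (λ { (here refl) → viaʳ (here refl) (proj₁ (dead-value u)) }) ,
  le (λ { (here refl) → viaˡ (there (here refl)) (≼-refl _) })
     (λ { (here refl) → viaʳ (here refl) (proj₂ (dead-value u)) })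

neg-openStar : ∀ l r u → neg (openStar l r u) ≡ openStar r l u
neg-openStar l r zero    = cong₂ ⟨_∣_⟩ (negs-centre r) (negs-centre l)
  where
  negs-centre : ∀ d → negs (centreOption d (int 0)) ≡ centreOption d (int 0)
  negs-centre true  = refl
  negs-centre false = refl
neg-openStar l r (suc u) = cong₂ ⟨_∣_⟩
  (cong₂ _∷_ (neg-openStar false r u) (negs-right r)) (cong₂ _∷_ (neg-openStar l false u) (negs-left l))
  where
  negs-right : ∀ d → negs (centreOption d (neg (int (suc u)))) ≡ centreOption d (int (suc u))
  negs-right true  = cong (_∷ []) (neg-involutive (int (suc u)))
  negs-right false = refl
  negs-left : ∀ d → negs (centreOption d (int (suc u))) ≡ centreOption d (neg (int (suc u)))
  negs-left true  = refl
  negs-left false = refl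

red-value : ∀ u → openStar false true (suc u) ≈ neg (hot u)
red-value u = ≈-trans (≈-reflexive (sym (neg-openStar true false (suc u)))) (neg-cong (blue-value u))

-- Meant for Left's move from u + 1 to u in the sum u + 1 + s u: the point given up is made good by
-- the second hot star.
s≼1+hot : ∀ u → s u ≼ int 1 ⊕ hot u
s≼1+hot u = le
  (λ X∈ → subst (_⧏ _) (sym (s-option Left u X∈)) (viaˡ (⊕-onʳ Left (int 1) (hot u) (here refl))
    (number-≼ (u + 1) (int# 0) (int# 1 ⊞ int# (suc u)) (solve (u ∷ [])))))
  (λ Y∈ → right-option (⊕-option⁻ Right (int 1) (hot u) Y∈))
  where
  right-option : ∀ {Y} → ⊕-Option Right (int 1) (hot u) Y → s u ⧏ Y
  right-option (onʳ (here refl)) = number-⧏ 0 (s# u) (int# 1 ⊞ s# u) refl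

-- A move in one switch is answered in the other, so each player gets one of them and u + 1 + s u
-- results. The other cases answer moves in u + 1 and in s u themselves.
hot⊕hot : ∀ u → hot u ⊕ hot u ≈ int (suc u) ⊕ s u
hot⊕hot u =
  le (λ X∈ → left-option (⊕-option⁻ Left (hot u) (hot u) X∈))
     (λ Y∈ → right-option′ (⊕-option⁻ Right (int (suc u)) (s u) Y∈)) ,
  le (λ X∈ → left-option′ (⊕-option⁻ Left (int (suc u)) (s u) X∈))
     (λ Y∈ → right-option (⊕-option⁻ Right (hot u) (hot u) Y∈))
  where
  left-option : ∀ {X} → ⊕-Option Left (hot u) (hot u) X → X ⧏ int (suc u) ⊕ s u
  left-option (onˡ (here refl)) = viaʳ (⊕-onʳ Right (int (suc u)) (hot u) (here refl)) (≼-refl _)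
  left-option (onʳ (here refl)) = viaʳ (⊕-onˡ Right (hot u) (int (suc u)) (here refl)) (proj₁ (⊕-comm _ _))
  right-option : ∀ {Y} → ⊕-Option Right (hot u) (hot u) Y → int (suc u) ⊕ s u ⧏ Y
  right-option (onˡ (here refl)) = viaˡ (⊕-onʳ Left (s u) (hot u) (here refl)) (proj₁ (⊕-comm _ _))
  right-option (onʳ (here refl)) = viaˡ (⊕-onˡ Left (hot u) (s u) (here refl)) (≼-refl _)
  right-option′ : ∀ {Y} → ⊕-Option Right (int (suc u)) (s u) Y → hot u ⊕ hot u ⧏ Y
  right-option′ (onʳ Y∈) with refl ← s-option Right u Y∈ = viaʳ (⊕-onˡ Right (hot u) (hot u) (here refl))
    (≼-trans (≈-≼-trans (⊕-comm _ _) (hot+star≼ Y∈)) (proj₂ (⊕-identityʳ (int (suc u)))))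
    where
    -- The membership is evidence that s u is *, so that Right is able to remove it after Left has
    -- taken the hot star.
    hot+star≼ : ∀ {Y} → Y ∈ right (s u) → hot u ⊕ s u ≼ int (suc u)
    hot+star≼ Y∈ = le (λ X∈ → case (⊕-option⁻ Left (hot u) (s u) X∈)) λ Z∈ → contradiction Z∈ (int-rightless (suc u))
      where
      case : ∀ {X} → ⊕-Option Left (hot u) (s u) X → X ⧏ int (suc u)
      case (onˡ (here refl)) = viaʳ (⊕-onʳ Right (int (suc u)) (s u) Y∈)
        (subst (λ Y → int (suc u) ⊕ Y ≼ int (suc u)) (sym (s-option Right u Y∈)) (proj₁ (⊕-identityʳ _)))
      case (onʳ X∈) with refl ← s-option Left u X∈ = viaʳ (⊕-onˡ Right (hot u) (int 0) (here refl))
        (number-≼ u (s# u ⊞ int# 0) (int# (suc u)) (solve (u ∷ [])))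
  left-option′ : ∀ {X} → ⊕-Option Left (int (suc u)) (s u) X → X ⧏ hot u ⊕ hot u
  left-option′ (onˡ (here refl)) = viaˡ (⊕-onˡ Left (hot u) (hot u) (here refl))
    (≼-≈-trans (⊕-monoʳ (int u) (s≼1+hot u))
      (≈-trans (≈-sym (⊕-assoc _ _ _)) (⊕-cong (≈-trans (int-⊕ u 1) (≈-reflexive (cong int (+-comm u 1)))) ≈-refl)))
  left-option′ (onʳ X∈) with refl ← s-option Left u X∈ = viaˡ (⊕-onˡ Left (hot u) (hot u) (here refl))
    (⊕-monoʳ (int (suc u)) (0≼hot X∈))
    where
    0≼hot : ∀ {X} → X ∈ left (s u) → int 0 ≼ hot u
    0≼hot X∈ = le (λ ()) λ { (here refl) → viaˡ X∈ (proj₂ (≈-reflexive (s-option Left u X∈))) }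

data StarNumber (x : Star) (l r j : ℕ) : Set where
  is : IsNumber (val x) l r j → StarNumber x l r j

dead# : ∀ u → StarNumber (blank false false u) 0 0 u
dead# u = is (≈# (dead-value u) (s# u))

left# : ∀ u → StarNumber (coloured Left u) u 0 0
left# u = is (int# u)

right# : ∀ u → StarNumber (coloured Right u) 0 u 0
right# u = is (neg# (int# u))

value# : ∀ {x y z lx rx jx ly ry jy lz rz jz G} → Separated ⟪ x , y , z ⟫ →
         StarNumber x lx rx jx → StarNumber y ly ry jy → StarNumber z lz rz jz →
         Realises ⟪ x , y , z ⟫ G → IsNumber G (ly + (lx + lz)) (ry + (rx + rz)) (jy + (jx + jz))
value# sep (is x#) (is y#) (is z#) r = ≈# (separated-value sep r) (y# ⊞ (x# ⊞ z#))

hot-pair# : ∀ {G} u v → Realises ⟪ blank true false (suc u) , coloured Left v , blank true false (suc u) ⟫ G →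
            IsNumber G (v + (suc u + 0)) 0 u
hot-pair# u v r = ≈# (separated-value coloured-centre r)
  (int# v ⊞ ≈# (≈-trans (⊕-cong (blue-value u) (blue-value u)) (hot⊕hot u)) (int# (suc u) ⊞ s# u))

-- The stars at b and c are adjacent and both uncoloured, yet only Left may take either centre. The
-- edge between them is inert, and they still count as a pair of hot stars.
hot-neighbours# : ∀ {G} u v →
                  Realises ⟪ coloured Left v , blank true false (suc u) , blank true false (suc u) ⟫ G →
                  IsNumber G (v + (suc u + 0)) 0 u
hot-neighbours# u v r = ≈# (separated-value (separated (swap (coloured-independent _ _ _)) (blue-independent _ _)) r)
  (≈# (≈-trans (⊕-cong (blue-value u) (⊕-cong ≈-refl (blue-value u))) (x∙yz≈y∙xz _ _ _))
      (int# v ⊞ ≈# (hot⊕hot u) (int# (suc u) ⊞ s# u)))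

hot-centre-value : ∀ {G} u v w → Realises ⟪ coloured Left v , blank true false (suc u) , coloured Left w ⟫ G →
                   G ≈ switch (int (v + w + suc u)) (int (v + w) ⊕ s u)
hot-centre-value u v w r =
  ≈-trans (separated-value coloured-ends r)
  (≈-trans (⊕-comm _ _) (≈-trans (⊕-cong (int-⊕ v w) (blue-value u)) (switch-shift (v + w) (suc u) (s u))))

hot-end-value : ∀ {G} u v w → Realises ⟪ coloured Left v , coloured Left w , blank true false (suc u) ⟫ G →
                G ≈ switch (int (w + v + suc u)) (int (w + v) ⊕ s u)
hot-end-value u v w r =
  ≈-trans (separated-value coloured-centre r)
  (≈-trans (≈-sym (⊕-assoc _ _ _)) (≈-trans (⊕-cong (int-⊕ w v) (blue-value u)) (switch-shift (w + v) (suc u) (s u))))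

-- The canonical form

neg-reflects-≼ : ∀ {G H} → neg G ≼ neg H → H ≼ G
neg-reflects-≼ {G} {H} p =
  subst (_≼ G) (neg-involutive H) (subst (neg (neg H) ≼_) (neg-involutive G) (neg-antitone p))

Incomparable : Game → Game → Set
Incomparable X Y = ¬ (X ≼ Y) × ¬ (Y ≼ X)

negs-incomparable : ∀ {Gs} → AllPairs Incomparable Gs → AllPairs Incomparable (negs Gs)
negs-incomparable {Gs} ps = subst (AllPairs Incomparable) (sym (negs≡map Gs))
  (AllPairs.map⁺ (AllPairs.map (λ (X⋠Y , Y⋠X) → (λ p → Y⋠X (neg-reflects-≼ p)) , λ p → X⋠Y (neg-reflects-≼ p)) ps))

neg-canonical : ∀ {G} → Canonical G → Canonical (neg G)
neg-canonical {G@(⟨ ls ∣ rs ⟩)} (canonical (dˡ , dʳ) (rˡ , rʳ) cˡ cʳ) = canonical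
  (negs-incomparable dʳ , negs-incomparable dˡ)
  ((λ X∈ Xʳ∈ p → reversibleˡ (neg-option⁻ Left G X∈) Xʳ∈ p) , λ Y∈ Yˡ∈ p → reversibleʳ (neg-option⁻ Right G Y∈) Yˡ∈ p)
  (λ X∈ → let _ , Z∈ , eq = neg-option⁻ Left G X∈ in subst Canonical (sym eq) (neg-canonical (cʳ Z∈)))
  (λ Y∈ → let _ , Z∈ , eq = neg-option⁻ Right G Y∈ in subst Canonical (sym eq) (neg-canonical (cˡ Z∈)))
  where
  reversibleˡ : ∀ {X Xʳ} → (∃ λ Z → Z ∈ right G × X ≡ neg Z) → Xʳ ∈ right X → ¬ (Xʳ ≼ neg G)
  reversibleˡ (Z , Z∈ , refl) Xʳ∈ p with _ , W∈ , refl ← neg-option⁻ Right Z Xʳ∈ = rʳ Z∈ W∈ (neg-reflects-≼ p)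
  reversibleʳ : ∀ {Y Yˡ} → (∃ λ Z → Z ∈ left G × Y ≡ neg Z) → Yˡ ∈ left Y → ¬ (neg G ≼ Yˡ)
  reversibleʳ (Z , Z∈ , refl) Yˡ∈ p with _ , W∈ , refl ← neg-option⁻ Left Z Yˡ∈ = rˡ Z∈ W∈ (neg-reflects-≼ p)

neg-± : ∀ Gs → neg (± Gs) ≡ ± Gs
neg-± Gs = cong (λ Hs → ⟨ Hs ∣ negs Gs ⟩) (negs-involutive Gs)

-- `± Gs` is its own negative, so the conditions on Right's side follow from those on Left's.
±-canonical : ∀ {Gs} → AllPairs Incomparable Gs →
              (∀ {X Xʳ} → X ∈ Gs → Xʳ ∈ right X → ¬ (Xʳ ≼ ± Gs)) →
              (∀ {X} → X ∈ Gs → Canonical X) → Canonical (± Gs)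
±-canonical {Gs} ps irreversible canonicals = canonical (ps , negs-incomparable ps)
  (irreversible , λ Y∈ → irreversible′ (neg-option⁻ Right (± Gs) Y∈))
  canonicals
  (λ Y∈ → let _ , Z∈ , eq = neg-option⁻ Right (± Gs) Y∈
          in subst Canonical (sym eq) (neg-canonical (canonicals Z∈)))
  where
  irreversible′ : ∀ {Y Yˡ} → (∃ λ Z → Z ∈ Gs × Y ≡ neg Z) → Yˡ ∈ left Y → ¬ (± Gs ≼ Yˡ)
  irreversible′ (Z , Z∈ , refl) Yˡ∈ p with W , W∈ , refl ← neg-option⁻ Left Z Yˡ∈ =
    irreversible Z∈ W∈ (neg-reflects-≼ (subst (_≼ neg W) (sym (neg-± Gs)) p))

-- Right's replies to Left's leaf moves at the start

int-leftless : ∀ i {X} → ¬ X ∈ left (neg (int i))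
int-leftless zero    ()
int-leftless (suc i) ()

-- Left has coloured a leaf of a and Right has answered at b. The leaves that remain at b, a and c
-- are u, v and w + 1; a is dead and c is open to Right only.
afterRedCentre : (u v w : ℕ) → Game
afterRedCentre u v w = neg (int u) ⊕ (s v ⊕ neg (hot w))

afterRedCentre-value : ∀ u v w {G} →
  Realises ⟪ blank false false v , coloured Right u , blank false true (suc w) ⟫ G → G ≈ afterRedCentre u v w
afterRedCentre-value u v w r =
  ≈-trans (separated-value coloured-centre r) (⊕-cong ≈-refl (⊕-cong (dead-value v) (red-value w)))

neg-hot≼1 : ∀ w → neg (hot w) ≼ int 1
neg-hot≼1 w = le (λ { (here refl) → number-⧏ 0 (neg# (s# w)) (int# 1) refl }) λ ()

afterRedCentre-left : ∀ u v w {X} → X ∈ left (afterRedCentre u v w) → X ≼ int 2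
afterRedCentre-left u v w X∈ with ⊕-option⁻ Left (neg (int u)) (s v ⊕ neg (hot w)) X∈
... | onˡ Y∈ = contradiction Y∈ (int-leftless u)
... | onʳ Y∈ with ⊕-option⁻ Left (s v) (neg (hot w)) Y∈
...   | onˡ Z∈ with refl ← s-option Left v Z∈ = ≼-trans (⊕-monoʳ (neg (int u)) (⊕-monoʳ (int 0) (neg-hot≼1 w)))
          (number-≼ u (neg# (int# u) ⊞ (int# 0 ⊞ int# 1)) (int# 2) (solve (u ∷ [])))
...   | onʳ (here refl) =
          number-≼ (u + 1) (neg# (int# u) ⊞ (s# v ⊞ neg# (s# w))) (int# 2) (solve (u ∷ []))

afterRedCentre-right : ∀ u v w → neg (int u) ⊕ (s v ⊕ neg (int (suc w))) ∈ right (afterRedCentre u v w)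
afterRedCentre-right u v w =
  ⊕-onʳ Right (neg (int u)) (s v ⊕ neg (hot w)) (⊕-onʳ Right (s v) (neg (hot w)) (here refl))

-- The star at c is worth at most 1 to Left, and a single red leaf of b makes up for that.
afterRedCentre≼s : ∀ u v w → afterRedCentre (suc u) v w ≼ s v
afterRedCentre≼s u v w = ≼-trans (⊕-monoʳ (neg (int (suc u))) (⊕-monoʳ (s v) (neg-hot≼1 w)))
  (number-≼-≡ u (neg# (int# (suc u)) ⊞ (s# v ⊞ int# 1)) (s# v) (cong s (+-identityʳ v)) (solve (u ∷ [])))

-- Left has coloured a leaf of b and Right has answered at a. Now b is dead with v leaves, while c
-- is still open to both players.
afterRedEnd : (v w : ℕ) → Game
afterRedEnd v w = s v ⊕ (neg (int (suc w)) ⊕ openStar true true (suc w))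

afterRedEnd-value : ∀ v w {G} →
  Realises ⟪ coloured Right (suc w) , blank false false v , blank true true (suc w) ⟫ G → G ≈ afterRedEnd v w
afterRedEnd-value v w r =
  ≈-trans (separated-value dead-centre r) (⊕-cong (dead-value v) ≈-refl)

afterRedEnd-left : ∀ v w {X} → X ∈ left (afterRedEnd v w) →
  X ≡ int 0 ⊕ (neg (int (suc w)) ⊕ openStar true true (suc w)) ⊎ X ≼ s v
afterRedEnd-left v w X∈ with ⊕-option⁻ Left (s v) (neg (int (suc w)) ⊕ openStar true true (suc w)) X∈
... | onˡ Y∈ with refl ← s-option Left v Y∈ = inj₁ refl
... | onʳ Y∈ with ⊕-option⁻ Left (neg (int (suc w))) (openStar true true (suc w)) Y∈
...   | onˡ Z∈ = contradiction Z∈ (int-leftless (suc w))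
...   | onʳ Z∈ = inj₂ (≼-trans (⊕-monoʳ (s v) (⊕-monoʳ (neg (int (suc w))) (bound Z∈)))
          (number-≼-≡ 0 (s# v ⊞ (neg# (int# (suc w)) ⊞ int# (suc w))) (s# v)
            (cong s (+-identityʳ v)) (solve (w ∷ []))))
  where
  bound : ∀ {Z} → Z ∈ left (openStar true true (suc w)) → Z ≼ int (suc w)
  bound (here refl)         = openStar≼int true false w
  bound (there (here refl)) = ≼-refl _

redEnd-right : ∀ w → neg (int (suc w)) ⊕ neg (int (suc w)) ∈ right (neg (int (suc w)) ⊕ openStar true true (suc w))
redEnd-right w = ⊕-onʳ Right (neg (int (suc w))) (openStar true true (suc w)) (there (here refl))

afterRedEnd-right : ∀ v w → s v ⊕ (neg (int (suc w)) ⊕ neg (int (suc w))) ∈ right (afterRedEnd v w)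
afterRedEnd-right v w = ⊕-onʳ Right (s v) (neg (int (suc w)) ⊕ openStar true true (suc w)) (redEnd-right w)

-- Left options bounded by s v are good enough, since s v and s (suc v) are confused. If Left
-- instead removes * from s v, Right takes c and is far ahead.
afterRedEnd≼s : ∀ v w → afterRedEnd v w ≼ s (suc v)
afterRedEnd≼s v w = le (λ X∈ → left-option (afterRedEnd-left v w X∈))
  (λ Y∈ → subst (afterRedEnd v w ⧏_) (sym (s-option Right (suc v) Y∈)) (viaʳ (afterRedEnd-right v w)
    (number-≼ (w + w + 1) (s# v ⊞ (neg# (int# (suc w)) ⊞ neg# (int# (suc w)))) (int# 0) (solve (w ∷ [])))))
  where
  left-option : ∀ {X} → X ≡ int 0 ⊕ (neg (int (suc w)) ⊕ openStar true true (suc w)) ⊎ X ≼ s v → X ⧏ s (suc v)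
  left-option (inj₁ refl) = viaʳ
    (⊕-onʳ Right (int 0) (neg (int (suc w)) ⊕ openStar true true (suc w)) (redEnd-right w))
    (number-≼ (w + w + 1) (int# 0 ⊞ (neg# (int# (suc w)) ⊞ neg# (int# (suc w)))) (s# (suc v)) (solve (w ∷ [])))
  left-option (inj₂ X≼s) = ≼-⧏-trans X≼s (s-alternates v)

afterRedEnd-left≼2 : ∀ v w {X} → X ∈ left (afterRedEnd v w) → X ≼ int 2
afterRedEnd-left≼2 v w X∈ with afterRedEnd-left v w X∈
... | inj₁ refl = ≼-trans
  (⊕-monoʳ (int 0) (⊕-monoʳ (neg (int (suc w))) (openStar≼int true true (suc w))))
  (number-≼ 0 (int# 0 ⊞ (neg# (int# (suc w)) ⊞ int# (suc (suc w)))) (int# 2) (solve (w ∷ [])))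
... | inj₂ X≼s = ≼-trans X≼s (number-≼ 1 (s# v) (int# 2) refl)

switch-canonical : ∀ {G H} → (∀ {Gʳ} → Gʳ ∈ right G → ¬ (Gʳ ≼ switch G H)) →
                   (∀ {Hˡ} → Hˡ ∈ left H → ¬ (switch G H ≼ Hˡ)) →
                   Canonical G → Canonical H → Canonical (switch G H)
switch-canonical rG rH cG cH = canonical
  (All.[] AllPairs.∷ AllPairs.[] , All.[] AllPairs.∷ AllPairs.[])
  ((λ { (here refl) → rG }) , λ { (here refl) → rH })
  (λ { (here refl) → cG }) (λ { (here refl) → cH })

-- Throughout, n = suc m.
module _ (m : ℕ) where

  centre-option : Game
  centre-option = (2 * suc m + 1) +s (suc m)

  -- Left owns both ends with n + 1 leaves each, and b is open to Left only. Taking b adds its n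
  -- leaves; a red leaf of b makes b dead with n - 1 leaves.
  threat : Game
  threat = switch (int (3 * suc m + 2)) ((2 * suc m + 2) +s m)

  end-option : Game
  end-option = switch threat (s (suc m))

  form : Game
  form = ± (centre-option ∷ end-option ∷ [])

  centre-option# : IsNumber centre-option (2 * suc m + 1) 0 (suc m)
  centre-option# = +s# (2 * suc m + 1) (suc m)

  reply# : IsNumber ((2 * suc m + 2) +s m) (2 * suc m + 2) 0 m
  reply# = +s# (2 * suc m + 2) m

  start centrePlayed endPlayed : State
  start        = ⟪ blank true true (suc (suc m)) , blank true true (suc m) , blank true true (suc (suc m)) ⟫
  centrePlayed = ⟪ blank true false (suc (suc m)) , coloured Left (suc m) , blank true false (suc (suc m)) ⟫
  endPlayed    = ⟪ coloured Left (suc (suc m)) , blank true false (suc m) , blank true true (suc (suc m)) ⟫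

  centrePlayed-value : ∀ {G} → Realises centrePlayed G → G ≈ centre-option
  centrePlayed-value r = number-≈ (hot-pair# (suc m) (suc m) r) centre-option# refl (solve (m ∷ []))

  0≼threat : int 0 ≼ threat
  0≼threat = +s≼switch 0 0 {G = int (3 * suc m + 2)} (0≼int (3 * suc m + 2))
    (number-⧏ (m + m + 3) (int# 0) reply# (solve (m ∷ [])))

  -- Right's option s n of `end-option` is confused with s (n - 1), which is all that `≼` asks of
  -- it.
  s≼end-option : s m ≼ end-option
  s≼end-option = subst (_≼ end-option) (0+s m)
    (+s≼switch 0 m {G = threat} 0≼threat
      (subst (_⧏ s (suc m)) (sym (0+s m)) (s-alternates m)))

  centre-option≼threat : centre-option ≼ threat
  centre-option≼threat = +s≼switch (2 * suc m + 1) (suc m)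
    (number-≼-≡ (m + 2) (int# (2 * suc m + 1)) (int# (3 * suc m + 2)) refl (solve (m ∷ [])))
    (number-⧏ 0 centre-option# reply# (solve (m ∷ [])))

  bothEnds-value : ∀ {G} → Realises ⟪ coloured Left (suc (suc m)) , blank true false (suc m) , coloured Left (suc (suc m)) ⟫ G → G ≈ threat
  bothEnds-value r = ≈-trans (hot-centre-value m (suc (suc m)) (suc (suc m)) r) (switch-cong
    (number-≈ (int# ((suc (suc m)) + (suc (suc m)) + suc m)) (int# (3 * suc m + 2)) refl (solve (m ∷ [])))
    (number-≈ (int# ((suc (suc m)) + (suc (suc m))) ⊞ s# m) reply# refl (solve (m ∷ []))))

  endPlayed-≼ : ∀ {G} → Realises endPlayed G → G ≼ end-option
  endPlayed-≼ r = le (λ X∈ → let _ , move , r′ = option⇒ r Left X∈ in left-option move r′)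
    (λ { (here refl) → replyʳ r (centreᶜ byRight) λ r′ →
         number-≼-≡ 0 (value# dead-centre (left# (suc (suc m))) (dead# (suc m)) (right# (suc (suc m))) r′) (s# (suc m))
           (cong s (+-identityʳ (suc m))) (solve (m ∷ [])) })
    where
    left-option : ∀ {st X} → Move Left endPlayed st → Realises st X → X ⧏ end-option
    -- After a leaf of a or b Right is free to take c, which balances Left's star at a. What remains
    -- is at most s (n - 1).
    left-option (leafᵃ onOwn) r′ = replyʳ r′ (centreᶜ byRight) λ r″ →
      ≼-trans (number-≼ 0 (value# dead-centre (left# (suc m)) (dead# (suc m)) (right# (suc (suc m))) r″) (s# m) (solve (m ∷ [])))
              s≼end-option
    left-option (leafᵇ onOpen) r′ = replyʳ r′ (centreᶜ byRight) λ r″ →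
      ≼-trans (number-≼-≡ 0 (value# dead-centre (left# (suc (suc m))) (dead# m) (right# (suc (suc m))) r″) (s# m)
                 (cong s (+-identityʳ m)) (solve (m ∷ [])))
              s≼end-option
    -- This shuts Right out of c, but b and c become equal hot stars with n leaves each, and the
    -- total 2n + 1 + s (n - 1) is below `threat`.
    left-option (leafᶜ onOpen) r′ = viaˡ (here refl)
      (≼-trans (number-≼-≡ 0 (hot-neighbours# m (suc (suc m)) r′) (+s# (2 * suc m + 1) m) refl (solve (m ∷ [])))
        (+s≼switch (2 * suc m + 1) m
          (number-≼-≡ (m + 2) (int# (2 * suc m + 1)) (int# (3 * suc m + 2)) refl (solve (m ∷ [])))
          (number-⧏ 0 (+s# (2 * suc m + 1) m) reply# (solve (m ∷ [])))))
    -- The same 3n + 2 is threatened as in `threat`, but Right's reply on a leaf of c leaves only 2n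
    -- + 1 + s n.
    left-option (centreᵇ byLeft) r′ = viaˡ (here refl)
      (≈-≼-trans (hot-end-value (suc m) (suc (suc m)) (suc m) r′)
        (switch-mono (number-≼-≡ 0 (int# ((suc m) + (suc (suc m)) + suc (suc m))) (int# (3 * suc m + 2)) refl (solve (m ∷ [])))
          (number-≼ 0 (int# ((suc m) + (suc (suc m))) ⊞ s# (suc m)) reply# (solve (m ∷ [])))))
    left-option (centreᶜ byLeft) r′ = viaˡ (here refl) (proj₁ (bothEnds-value r′))

  -- The bound is what Left secures at c after Right has coloured a leaf of b; in `end-option` Right
  -- answers `threat` by moving to just this value.
  end-option≼q : end-option ≼ (2 * suc m + 2) +s m
  end-option≼q = le (λ { (here refl) → viaʳ (here refl) (≼-refl _) })
    (λ Y∈ → subst (end-option ⧏_) (sym (+s-right (2 * suc m + 2) m Y∈))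
      (viaʳ (here refl) (number-≼ (m + m + 3) (s# (suc m)) (int# (2 * suc m + 2)) (solve (m ∷ [])))))

  -- Shutting Left out of c by a leaf costs Right that leaf: even after taking c, Right has n leaves
  -- there against Left's n + 1 at a. Moving to s n at once is at least as good for Right.
  s≼endPlayedLeaf : ∀ {G} → Realises ⟪ coloured Left (suc (suc m)) , blank true false (suc m) , blank false true (suc m) ⟫ G → s (suc m) ≼ G
  s≼endPlayedLeaf {G} r = le
    (λ X∈ → subst (_⧏ G) (sym (s-option Left (suc m) X∈))
      (replyˡ r (centreᵇ byLeft) λ r′ →
        number-≼ (m + m + 2) (int# 0) (value# coloured-centre (left# (suc (suc m))) (left# (suc m)) (dead# (suc m)) r′) (solve (m ∷ []))))
    (λ Y∈ → let _ , move , r′ = option⇒ r Right Y∈ in right-option move r′)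
    where
    right-option : ∀ {st Y} → Move Right ⟪ coloured Left (suc (suc m)) , blank true false (suc m) , blank false true (suc m) ⟫ st →
                   Realises st Y → s (suc m) ⧏ Y
    -- A leaf of c is enough: it makes c dead, and Left's n + 1 leaves at a decide.
    right-option (leafᵇ onOpen) r′ = replyˡ r′ (leafᶜ onOpen) λ r″ →
      number-≼ (m + 1) (s# (suc m)) (value# dead-centre (left# (suc (suc m))) (dead# m) (dead# m) r″) (solve (m ∷ []))
    right-option (leafᶜ onOpen) r′ = replyˡ r′ (centreᵇ byLeft) λ r″ →
      number-≼ (m + m + 2) (s# (suc m)) (value# coloured-centre (left# (suc (suc m))) (left# (suc m)) (dead# m) r″) (solve (m ∷ []))
    right-option (centreᶜ byRight) r′ =
      number-⧏ 0 (s# (suc m)) (value# dead-centre (left# (suc (suc m))) (dead# (suc m)) (right# (suc m)) r′) (solve (m ∷ []))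

  endPlayed-≽ : ∀ {G} → Realises endPlayed G → end-option ≼ G
  endPlayed-≽ r = le
    (λ { (here refl) → replyˡ r (centreᶜ byLeft) λ r′ → proj₂ (bothEnds-value r′) })
    (λ Y∈ → let _ , move , r′ = option⇒ r Right Y∈ in right-option move r′)
    where
    right-option : ∀ {st Y} → Move Right endPlayed st → Realises st Y → end-option ⧏ Y
    right-option (leafᵇ onOpen) r′ = replyˡ r′ (centreᶜ byLeft) λ r″ →
      ≼-trans end-option≼q
        (number-≼-≡ 0 reply# (value# dead-centre (left# (suc (suc m))) (dead# m) (left# (suc (suc m))) r″)
          (sym (cong s (+-identityʳ m))) (solve (m ∷ [])))
    right-option (leafᶜ onOpen) r′ = viaʳ (here refl) (s≼endPlayedLeaf r′)
    right-option (centreᶜ byRight) r′ = viaʳ (here refl)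
      (number-≼-≡ 0 (s# (suc m)) (value# dead-centre (left# (suc (suc m))) (dead# (suc m)) (right# (suc (suc m))) r′)
        (sym (cong s (+-identityʳ (suc m)))) (solve (m ∷ [])))

  endPlayed-value : ∀ {G} → Realises endPlayed G → G ≈ end-option
  endPlayed-value r = endPlayed-≼ r , endPlayed-≽ r

  -- Packages what Right's replies to leaf moves have in common. Already for n = 1, 2 is the largest
  -- integer below 2n + 1 + s n, so Left options up to 2 are beaten by `centre-option`.
  ≼-form : ∀ {G} → (∀ {X} → X ∈ left G → X ≼ int 2) → G ⧏ neg centre-option → G ≼ s (suc m) → G ≼ form
  ≼-form {G} left≼2 G⧏ G≼s = le
    (λ X∈ → viaˡ (here refl) (≼-trans (left≼2 X∈) (number-≼ (m + m) (int# 2) centre-option# (solve (m ∷ [])))))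
    (λ { (here refl)         → G⧏
       ; (there (here refl)) → viaˡ (here refl) (subst (G ≼_) (sym (neg-s (suc m))) G≼s) })

  afterLeaf-⧏ : ∀ {G} →
    Realises ⟪ blank true false (suc m) , blank true true (suc m) , blank true true (suc (suc m)) ⟫ G → G ⧏ form
  afterLeaf-⧏ r = replyʳ r (centreᵇ byRight) λ r′ →
    ≈-≼-trans (afterRedCentre-value (suc m) (suc m) (suc m) r′)
      (≼-form (afterRedCentre-left (suc m) (suc m) (suc m))
        -- Right goes on to take c, which gives -n - (n + 1) + s n, exactly the negative of
        -- `centre-option`.
        (viaʳ (afterRedCentre-right (suc m) (suc m) (suc m))
          (number-≼-≡ 0 (neg# (int# (suc m)) ⊞ (s# (suc m) ⊞ neg# (int# (suc (suc m))))) (neg# centre-option#)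
            (cong s (+-identityʳ (suc m))) (solve (m ∷ []))))
        (afterRedCentre≼s m (suc m) (suc m)))

  afterCentreLeaf-⧏ : ∀ {G} →
    Realises ⟪ blank true true (suc (suc m)) , blank true false m , blank true true (suc (suc m)) ⟫ G → G ⧏ form
  afterCentreLeaf-⧏ r = replyʳ r (centreᵃ byRight) λ r′ →
    ≈-≼-trans (afterRedEnd-value m (suc m) r′)
      (≼-form (afterRedEnd-left≼2 m (suc m))
        -- Right goes on to take c, which gives -2(n + 1) + s (n - 1), a full point below -(2n + 1)
        -- whatever the nimbers.
        (viaʳ (afterRedEnd-right m (suc m))
          (number-≼ 0 (s# m ⊞ (neg# (int# (suc (suc m))) ⊞ neg# (int# (suc (suc m))))) (neg# centre-option#) (solve (m ∷ []))))
        (afterRedEnd≼s m (suc m)))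

  start-≼ : ∀ {G} → Realises start G → G ≼ form
  start-≼ {G} r = le (λ X∈ → let _ , move , r′ = option⇒ r Left X∈ in left-option move r′)
    (λ { (here refl)         → replyʳ r (centreᵇ byRight) λ r′ → negated (λ s → proj₂ (centrePlayed-value s)) r′
       ; (there (here refl)) → replyʳ r (centreᵃ byRight) λ r′ → negated (λ s → proj₂ (endPlayed-value s)) r′ })
    where
    -- Right's move leads to the colour exchange of a position already evaluated for Left, so a
    -- lower bound there becomes an upper bound here.
    negated : ∀ {st X H} → (∀ {Y} → Realises (swapState st) Y → H ≼ Y) → Realises st X → X ≼ neg H
    negated {X = X} {H} H≼ r = subst (_≼ neg H) (neg-involutive X)
      (neg-antitone (H≼ (swap-realises (wellFounded X) r)))
    left-option : ∀ {st X} → Move Left start st → Realises st X → X ⧏ form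
    left-option (leafᵃ onOpen)   r′ = afterLeaf-⧏ r′
    left-option (leafᵇ onOpen)   r′ = afterCentreLeaf-⧏ r′
    left-option (leafᶜ onOpen)   r′ = afterLeaf-⧏ (mirror-realises r′)
    left-option (centreᵃ byLeft) r′ = viaˡ (there (here refl)) (proj₁ (endPlayed-value r′))
    left-option (centreᵇ byLeft) r′ = viaˡ (here refl) (proj₁ (centrePlayed-value r′))
    left-option (centreᶜ byLeft) r′ = viaˡ (there (here refl)) (proj₁ (endPlayed-value (mirror-realises r′)))

  start-value : ∀ {G} → Realises start G → form ≈ G
  start-value {G} r =
    subst₂ _≼_ (neg-± _) (neg-involutive G) (neg-antitone (start-≼ (swap-realises (wellFounded G) r))) , start-≼ r

  -- Canonicity of the claimed form

  centre-option-canonical : Canonical centre-option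
  centre-option-canonical = proj₁ (+s-canonicalForm (2 * suc m + 1) (suc m))

  threat-canonical : Canonical threat
  threat-canonical = switch-canonical
    (λ Xʳ∈ _ → int-rightless (3 * suc m + 2) Xʳ∈)
    (λ { Yˡ∈ (le f _) → ⧏⇒⋡ (f (here refl)) (≼-trans (+s-left≼ (2 * suc m + 2) m Yˡ∈)
      (number-≼-≡ (suc m) (int# (2 * suc m + 2)) (int# (3 * suc m + 2)) refl (solve (m ∷ [])))) })
    (int-canonical (3 * suc m + 2)) (proj₁ (+s-canonicalForm (2 * suc m + 2) m))

  s≼q : s (suc m) ≼ (2 * suc m + 2) +s m
  s≼q = number-≼ (m + m + 3) (s# (suc m)) reply# (solve (m ∷ []))

  end-option-canonical : Canonical end-option
  end-option-canonical = switch-canonical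
    (λ { (here refl) (le _ g) → ⧏⇒⋡ (g (here refl)) s≼q })
    (λ { Yˡ∈ (le f _) → ⧏⇒⋡ (f (here refl)) (subst (_≼ threat) (sym (s-option Left (suc m) Yˡ∈)) 0≼threat) })
    threat-canonical (subst Canonical (0+s (suc m)) (proj₁ (+s-canonicalForm 0 (suc m))))

  s≼centre-option : s (suc m) ≼ centre-option
  s≼centre-option = number-≼ (m + m + 2) (s# (suc m)) centre-option# (solve (m ∷ []))

  form-canonical : Canonical form
  form-canonical = ±-canonical
    -- The two Left options are incomparable: Right can lower `end-option` to s n, which is below
    -- `centre-option`, while Left can raise it to `threat`, which is above.
    ((((λ { (le _ g) → ⧏⇒⋡ (g (here refl)) s≼centre-option }) ,
       (λ { (le f _) → ⧏⇒⋡ (f (here refl)) centre-option≼threat })) All.∷ All.[]) AllPairs.∷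
     (All.[] AllPairs.∷ AllPairs.[]))
    -- Nothing reverses: Right can move from `form` to -(2n + 1 + s n), which is below every Right
    -- option of a Left option.
    (λ { (here refl)         Xʳ∈         (le _ g) → ⧏⇒⋡ (g (here refl))
           (subst (neg centre-option ≼_) (sym (+s-right (2 * suc m + 1) (suc m) Xʳ∈))
             (number-≼ (4 * m + 5) (neg# centre-option#) (int# (2 * suc m + 1)) (solve (m ∷ []))))
       ; (there (here refl)) (here refl) (le _ g) → ⧏⇒⋡ (g (here refl))
           (number-≼ (m + m + 2) (neg# centre-option#) (s# (suc m)) (solve (m ∷ []))) })
    (λ { (here refl) → centre-option-canonical ; (there (here refl)) → end-option-canonical })

theorem8 : ∀ (n : ℕ) → n ≥ 1 →
    ± ( (2 * n + 1) +s n
    ∷ ⟨ ⟨ int (3 * n + 2) ∷ [] ∣ (2 * n + 2) +s (n ∸ 1) ∷ [] ⟩ ∷ [] ∣ s n ∷ [] ⟩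
    ∷ [])
    IsCanonicalFormOf snort (caterpillar (n + 1) n (n + 1))
theorem8 n@(suc m) _ = form-canonical m , start-value m
  (subst (λ k → Realises ⟪ blank true true k , blank true true n , blank true true k ⟫ (snort (caterpillar (n + 1) n (n + 1))))
         -- `n + 1` does not compute to `suc n`, the leaf count in `start`, so the end stars are
         -- rewritten.
         (+-comm n 1) (snort-realises (n + 1) n (n + 1)))
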